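{- Let $n=2^sm$ with $2^s\geq 4$ and $m$ odd. If a symmetric vector $(a_0,a_1,\ldots,a_{n-1})\in\mathbb{F}_2^n$ is the corresponding vector of a normal element of $\mathbb{F}_{2^n}$ over $\mathbb{F}_2$, then the following hold (sums of the $a_j$ being taken in $\mathbb{F}_2$): 1) $\sum_{i=0}^{m-1}a_{i2^s}=1$ and $\sum_{i=0}^{m-1}a_{i2^s+2^{s-1}}=0$; 2) $\sum_{1\leq k\leq 2^{s-1}-1,\ k\text{ odd}}\ \sum_{i=0}^{m-1}a_{i2^s+k}=1$; 3) $\gcd\left(\sum_{0\leq k\leq m-1}\left(\sum_{i=0}^{2^s-1}a_{im+k}\right)x^k,\ x^m-1\right)=1$ in $\mathbb{F}_2[x]$.
   Context: An element $\alpha\in\mathbb{F}_{2^n}$ is a normal element of $\mathbb{F}_{2^n}$ over $\mathbb{F}_2$ if $\{\alpha,\alpha^2,\alpha^{2^2},\ldots,\alpha^{2^{n-1}}\}$ is a basis of $\mathbb{F}_{2^n}$ over $\mathbb{F}_2$. The trace function is $\mathrm{Tr}_{2^n|2}(x)=\sum_{i=0}^{n-1}x^{2^i}$. The corresponding vector of $\alpha\in\mathbb{F}_{2^n}$ is $(a_0,\ldots,a_{n-1})\in\mathbb{F}_2^n$ with $a_i=\mathrm{Tr}_{2^n|2}(\alpha\cdot\alpha^{2^i})$ for $0\leq i\leq n-1$. A vector $(a_0,\ldots,a_{n-1})$ is symmetric if $a_i=a_{n-i}$ for all $1\leq i\leq n-1$. -}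

module Defs where

open import Level using (Level; _⊔_; 0ℓ)
open import Algebra.Apartness.Bundles using (HeytingField; HeytingCommutativeRing)
open import Algebra.Bundles using (CommutativeRing)
open import Algebra.Bundles.Raw using (RawRing)
import Algebra.Definitions.RawSemiring as RawSemiringDefs
import Algebra.Properties.Semiring.Exp as SemiringExp
import Algebra.Properties.Semiring.Sum as SemiringSum
open import Data.Fin.Base using (Fin; toℕ)
open import Data.List.Base as List using (List; []; _∷_)
open import Data.Nat.Base as ℕ using (ℕ; zero; suc; _∸_; _≤_)
open import Data.Nat.DivMod using (_mod_)
open import Data.Parity.Base as ℙ using (Parity; 0ℙ; 1ℙ)
import Data.Parity.Properties as ℙ
open import Data.Product.Base using (∃-syntax)
open import Data.Vec.Functional using (Vector)
open import Function.Bundles using (Inverse)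
open import Relation.Binary.PropositionalEquality using (_≡_; setoid)

-- The field 𝔽₂ is Parity, with the library's ring structure on it.

private
  module 𝔽₂ = CommutativeRing ℙ.+-*-commutativeRing

open SemiringSum 𝔽₂.semiring public using (sum; sum-syntax)

-- Entry a_j of a vector (a₀, …, a_{n-1}), for a natural number j.  For j < n
-- this is the entry at j; an out-of-range j is reduced modulo n.  The clause
-- for the empty vector only serves to make the function total.

infix 9 _‼_

_‼_ : ∀ {n} → Vector Parity n → ℕ → Parity
_‼_ {zero}  a j = 0ℙ
_‼_ {suc n} a j = a (j mod suc n)

IsSymmetric : ∀ {n} → Vector Parity n → Set
IsSymmetric {n} a = ∀ i → 1 ≤ i → i ≤ n ∸ 1 → a ‼ i ≡ a ‼ (n ∸ i)

-- A Heyting field whose underlying setoid is in bijection with Fin q has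
-- decidable equality and decidable apartness, so it is a field with q
-- elements in the usual sense (0 and 1 are distinct because 1 is apart
-- from 0).  Hence 𝔽_{2ⁿ} is a Heyting field F with HasOrder F (2 ^ n).

module _ {c ℓ₁ ℓ₂ : Level} (F : HeytingField c ℓ₁ ℓ₂) where

  private
    R : CommutativeRing c ℓ₁
    R = HeytingCommutativeRing.commutativeRing (HeytingField.heytingCommutativeRing F)
    module R = CommutativeRing R
    module Sum = SemiringSum R.semiring

  open R using (Carrier; _≈_; _*_; 0#; 1#)
  open SemiringExp R.semiring using (_^_)

  HasOrder : ℕ → Set (c ⊔ ℓ₁)
  HasOrder q = Inverse R.setoid (setoid (Fin q))

  -- The inclusion of 𝔽₂ as the prime subfield (a ring homomorphism when F
  -- has characteristic 2).

  ι : Parity → Carrier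
  ι 0ℙ = 0#
  ι 1ℙ = 1#

  linearCombination : ∀ {k} → Vector Parity k → Vector Carrier k → Carrier
  linearCombination γ v = Sum.sum (λ i → ι (γ i) * v i)

  record IsBasis {k : ℕ} (v : Vector Carrier k) : Set (c ⊔ ℓ₁) where
    field
      independent : ∀ γ → linearCombination γ v ≈ 0# → ∀ i → γ i ≡ 0ℙ
      spanning    : ∀ x → ∃[ γ ] linearCombination γ v ≈ x

  IsNormal : ℕ → Carrier → Set (c ⊔ ℓ₁)
  IsNormal n α = IsBasis {n} (λ i → α ^ (2 ℕ.^ toℕ i))

  Tr : ℕ → Carrier → Carrier
  Tr n x = Sum.sum {n} (λ i → x ^ (2 ℕ.^ toℕ i))

  -- The trace takes values in the prime subfield, so the entries aᵢ ∈ 𝔽₂ are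
  -- compared with it inside F.

  IsCorrespondingVector : ∀ {n} → Carrier → Vector Parity n → Set ℓ₁
  IsCorrespondingVector {n} α a = ∀ i → ι (a i) ≈ Tr n (α * α ^ (2 ℕ.^ toℕ i))

-- 𝔽₂[x]: the list c₀ ∷ c₁ ∷ … ∷ [] stands for c₀ + c₁x + ….  Lists differing
-- by trailing zeros denote the same polynomial, so equality is _≈ₚ_.

Poly : Set
Poly = List Parity

coeff : Poly → ℕ → Parity
coeff []      j       = 0ℙ
coeff (c ∷ p) zero    = c
coeff (c ∷ p) (suc j) = coeff p j

infix  4 _≈ₚ_
infixl 6 _+ₚ_ _-ₚ_
infixl 7 _*ₚ_

_≈ₚ_ : Poly → Poly → Set
p ≈ₚ q = ∀ j → coeff p j ≡ coeff q j

_+ₚ_ : Poly → Poly → Poly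
[]      +ₚ q       = q
(c ∷ p) +ₚ []      = c ∷ p
(c ∷ p) +ₚ (d ∷ q) = (c 𝔽₂.+ d) ∷ (p +ₚ q)

-- (c + x p) q = c q + x (p q)

_*ₚ_ : Poly → Poly → Poly
[]      *ₚ q = []
(c ∷ p) *ₚ q = List.map (c 𝔽₂.*_) q +ₚ (0ℙ ∷ (p *ₚ q))

𝔽₂[x] : RawRing 0ℓ 0ℓ
𝔽₂[x] = record
  { Carrier = Poly
  ; _≈_     = _≈ₚ_
  ; _+_     = _+ₚ_
  ; _*_     = _*ₚ_
  ; -_      = List.map (λ c → 𝔽₂.- c)
  ; 0#      = []
  ; 1#      = 1ℙ ∷ []
  }

module Polyᵈ = RawSemiringDefs (RawRing.rawSemiring 𝔽₂[x])

open Polyᵈ public using () renaming (_∣_ to _∣ₚ_; _^_ to _^ₚ_)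

1ₚ X : Poly
1ₚ = RawRing.1# 𝔽₂[x]
X  = 0ℙ ∷ 1ℙ ∷ []

_-ₚ_ : Poly → Poly → Poly
p -ₚ q = p +ₚ RawRing.-_ 𝔽₂[x] q

constant : Parity → Poly
constant c = c ∷ []

-- ∑_{0 ≤ k < m} c_k xᵏ
polynomial : ∀ {m} → Vector Parity m → Poly
polynomial c = Polyᵈ.sum (λ k → constant (c k) *ₚ X ^ₚ toℕ k)

-- The units of 𝔽₂[x] reduce to 1, so a greatest common divisor is unique.

record IsGCD (f g d : Poly) : Set where
  field
    divides₁ : d ∣ₚ f
    divides₂ : d ∣ₚ g
    greatest : ∀ {e} → e ∣ₚ f → e ∣ₚ g → e ∣ₚ d

{-# OPTIONS --safe #-}
module Submission where

-- Let A_j = α^(2^j), a sequence of period n on which the Frobenius map acts as the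
-- shift, so that a_k = ∑_{i<n} A_i A_{k+i}.  For n = q d the relative traces
-- T_j = ∑_{i<q} A_{id+j} have period d, and ∑_{i<q} a_{id+k} = ∑_{r<d} T_r T_{k+r}.
-- With d = 2^s the shift k = 0 gives (∑ T_r)² = Tr(α) = 1, and at k = d/2 the terms
-- cancel in pairs.  The odd shifts k < d/2 add up to γ γ² for γ = ∑ T_{2r}, and
-- γ + γ² = 1 forces γ γ² = 1.
--
-- With d = m let e h = x^m − 1 for a common divisor e of the two polynomials.
-- Polynomials act on sequences through the shift, and h annihilates
-- k ↦ Tr(α T_k); by nondegeneracy of the trace form it annihilates T.  By
-- normality of α the remainder of h modulo x^m − 1 then vanishes, so e is a unit.

open import Defs
open import Algebra.Apartness.Bundles using (HeytingField; HeytingCommutativeRing)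
import Algebra.Apartness.Properties.HeytingCommutativeRing as HeytingProperties
open import Algebra.Bundles using (CommutativeMonoid; CommutativeRing)
open import Algebra.Definitions.RawMagma using (_,_)
import Algebra.Properties.CommutativeMonoid.Sum as MonoidSum
import Algebra.Properties.CommutativeSemigroup as CommutativeSemigroupProperties
import Algebra.Properties.CommutativeSemiring.Exp as CommutativeSemiringExp
import Algebra.Properties.Ring as RingProperties
import Algebra.Properties.Semiring.Exp as SemiringExp
import Algebra.Properties.Semiring.Mult as SemiringMult
import Algebra.Solver.CommutativeMonoid as CommutativeMonoidSolver
open import Data.Bool.Base using (if_then_else_)
open import Data.Fin.Base using (Fin; toℕ; fromℕ<; punchIn)
open import Data.Fin.Permutation using (Permutation′; permutation; _⟨$⟩ʳ_)
open import Data.Fin.Properties using (any?; punchInᵢ≢i; toℕ-fromℕ<) renaming (_≟_ to _≟ᶠ_)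
open import Data.List.Base as List using ([]; _∷_)
open import Data.Nat.Base as ℕ using (ℕ; zero; suc; _∸_; _≤_; _<_; z<s; s<s; s≤s; NonZero; parity)
open import Data.Nat.Divisibility using (∣-refl)
open import Data.Nat.DivMod using (_/_; _%_; _mod_; m≡m%n+[m/n]*n; m%n<n; m<n⇒m%n≡m; [m+n]%n≡m%n; +-distrib-/-∣ˡ; n/n≡1)
import Data.Nat.Properties as ℕ
open import Data.Nat.Solver using (module +-*-Solver)
open import Data.Parity.Base as ℙ using (Parity; 0ℙ; 1ℙ)
open import Data.Parity.Properties using (_≟_)
import Data.Parity.Properties as ℙ
open import Data.Product.Base using (∃-syntax; _×_; _,_; proj₁)
open import Data.Sum.Base using (_⊎_; inj₁; inj₂)
open import Data.Vec.Functional using (Vector; removeAt)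
open import Function.Bundles using (Inverse)
open import Relation.Binary.PropositionalEquality as ≡ using (_≡_; cong)
import Relation.Binary.Reasoning.Setoid as ≈-Reasoning
open import Relation.Nullary using (¬_; yes; no; contradiction)
open import Relation.Nullary.Decidable using (does)

-- Sums over initial segments of ℕ, and periodic sequences

module RangeSums {c ℓ} (M : CommutativeMonoid c ℓ) where

  open CommutativeMonoid M
  open MonoidSum M using () renaming (sum to sumFin)
  open CommutativeSemigroupProperties commutativeSemigroup using (interchange)
  open ≈-Reasoning setoid

  -- Summands are indexed by ℕ rather than `Fin`, so that shifting and splitting the range is plain
  -- arithmetic on indices; values of f from n on are ignored.
  sumTo : ℕ → (ℕ → Carrier) → Carrier
  sumTo zero    f = ε
  sumTo (suc n) f = f 0 ∙ sumTo n (λ i → f (suc i))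

  sumFin≈sumTo : ∀ n f → sumFin {n} (λ i → f (toℕ i)) ≈ sumTo n f
  sumFin≈sumTo zero    f = refl
  sumFin≈sumTo (suc n) f = ∙-congˡ (sumFin≈sumTo n (λ i → f (suc i)))

  Periodic : ℕ → (ℕ → Carrier) → Set ℓ
  Periodic d f = ∀ i → f (d ℕ.+ i) ≈ f i

  sumTo-cong-< : ∀ n {f g} → (∀ i → i < n → f i ≈ g i) → sumTo n f ≈ sumTo n g
  sumTo-cong-< zero    f≈g = refl
  sumTo-cong-< (suc n) f≈g = ∙-cong (f≈g 0 z<s) (sumTo-cong-< n (λ i i<n → f≈g (suc i) (s<s i<n)))

  sumTo-cong : ∀ n {f g} → (∀ i → f i ≈ g i) → sumTo n f ≈ sumTo n g
  sumTo-cong n f≈g = sumTo-cong-< n (λ i _ → f≈g i)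

  sumTo-zero : ∀ n {f} → (∀ i → f i ≈ ε) → sumTo n f ≈ ε
  sumTo-zero zero    f≈ε = refl
  sumTo-zero (suc n) f≈ε = trans (∙-cong (f≈ε 0) (sumTo-zero n (λ i → f≈ε (suc i)))) (identityˡ ε)

  sumTo-∙ : ∀ n f g → sumTo n (λ i → f i ∙ g i) ≈ sumTo n f ∙ sumTo n g
  sumTo-∙ zero    f g = sym (identityˡ ε)
  sumTo-∙ (suc n) f g = trans (∙-congˡ (sumTo-∙ n (λ i → f (suc i)) (λ i → g (suc i))))
    (interchange (f 0) (g 0) _ _)

  sumTo-swap : ∀ m n (f : ℕ → ℕ → Carrier) →
    sumTo m (λ i → sumTo n (f i)) ≈ sumTo n (λ j → sumTo m (λ i → f i j))
  sumTo-swap zero    n f = sym (sumTo-zero n (λ j → refl))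
  sumTo-swap (suc m) n f = trans (∙-congˡ (sumTo-swap m n (λ i → f (suc i))))
    (sym (sumTo-∙ n (f 0) _))

  sumTo-last : ∀ n f → sumTo (suc n) f ≈ sumTo n f ∙ f n
  sumTo-last zero    f = comm (f 0) ε
  sumTo-last (suc n) f = trans (∙-congˡ (sumTo-last n (λ i → f (suc i)))) (sym (assoc _ _ _))

  sumTo-++ : ∀ m n f → sumTo (m ℕ.+ n) f ≈ sumTo m f ∙ sumTo n (λ i → f (m ℕ.+ i))
  sumTo-++ zero    n f = sym (identityˡ _)
  sumTo-++ (suc m) n f = trans (∙-congˡ (sumTo-++ m n (λ i → f (suc i)))) (sym (assoc _ _ _))

  sumTo-blocks : ∀ q d f →
    sumTo (q ℕ.* d) f ≈ sumTo q (λ i → sumTo d (λ r → f (i ℕ.* d ℕ.+ r)))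
  sumTo-blocks zero    d f = refl
  sumTo-blocks (suc q) d f = begin
    sumTo (d ℕ.+ q ℕ.* d) f
      ≈⟨ sumTo-++ d (q ℕ.* d) f ⟩
    sumTo d f ∙ sumTo (q ℕ.* d) (λ i → f (d ℕ.+ i))
      ≈⟨ ∙-congˡ (sumTo-blocks q d (λ i → f (d ℕ.+ i))) ⟩
    sumTo d f ∙ sumTo q (λ i → sumTo d (λ r → f (d ℕ.+ (i ℕ.* d ℕ.+ r))))
      ≈⟨ ∙-congˡ (sumTo-cong q λ i → sumTo-cong d λ r →
           reflexive (cong f (≡.sym (ℕ.+-assoc d (i ℕ.* d) r)))) ⟩
    sumTo (suc q) (λ i → sumTo d (λ r → f (i ℕ.* d ℕ.+ r))) ∎

  sumTo-even-odd : ∀ n f →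
    sumTo (n ℕ.* 2) f ≈ sumTo n (λ i → f (i ℕ.* 2)) ∙ sumTo n (λ i → f (suc (i ℕ.* 2)))
  sumTo-even-odd zero    f = sym (identityˡ _)
  sumTo-even-odd (suc n) f = begin
    f 0 ∙ (f 1 ∙ sumTo (n ℕ.* 2) (λ i → f (2 ℕ.+ i)))
      ≈⟨ assoc _ _ _ ⟨
    (f 0 ∙ f 1) ∙ sumTo (n ℕ.* 2) (λ i → f (2 ℕ.+ i))
      ≈⟨ ∙-congˡ (sumTo-even-odd n (λ i → f (2 ℕ.+ i))) ⟩
    (f 0 ∙ f 1) ∙ (sumTo n (λ i → f (2 ℕ.+ i ℕ.* 2)) ∙ sumTo n (λ i → f (3 ℕ.+ i ℕ.* 2)))
      ≈⟨ interchange (f 0) (f 1) _ _ ⟩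
    sumTo (suc n) (λ i → f (i ℕ.* 2)) ∙ sumTo (suc n) (λ i → f (suc (i ℕ.* 2))) ∎

  -- Both sides run over the values of f at 1, ..., n; index 0 is left out.
  sumTo-reverse : ∀ n (f : ℕ → Carrier) → sumTo n (λ i → f (suc i)) ≈ sumTo n (λ i → f (n ∸ i))
  sumTo-reverse zero    f = refl
  sumTo-reverse (suc n) f = begin
    sumTo (suc n) (λ i → f (suc i))          ≈⟨ sumTo-last n (λ i → f (suc i)) ⟩
    sumTo n (λ i → f (suc i)) ∙ f (suc n)    ≈⟨ comm _ _ ⟩
    f (suc n) ∙ sumTo n (λ i → f (suc i))    ≈⟨ ∙-congˡ (sumTo-reverse n f) ⟩
    sumTo (suc n) (λ i → f (suc n ∸ i))      ∎

  -- The value at d that enters equals the value at 0 that leaves.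
  sumTo-rotate : ∀ d f → Periodic d f → sumTo d (λ i → f (suc i)) ≈ sumTo d f
  sumTo-rotate zero    f per = refl
  sumTo-rotate (suc d) f per = begin
    sumTo (suc d) (λ i → f (suc i))         ≈⟨ sumTo-last d (λ i → f (suc i)) ⟩
    sumTo d (λ i → f (suc i)) ∙ f (suc d)   ≈⟨ comm _ _ ⟩
    f (suc d) ∙ sumTo d (λ i → f (suc i))   ≈⟨ ∙-congʳ (trans (reflexive (cong f (≡.sym (ℕ.+-identityʳ (suc d))))) (per 0)) ⟩
    sumTo (suc d) f                         ∎

  sumTo-shift : ∀ d f → Periodic d f → ∀ t → sumTo d (λ i → f (t ℕ.+ i)) ≈ sumTo d f
  sumTo-shift d f per zero    = refl
  sumTo-shift d f per (suc t) = trans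
    (sumTo-shift d (λ i → f (suc i))
      (λ i → trans (reflexive (cong f (≡.sym (ℕ.+-suc d i)))) (per (suc i))) t)
    (sumTo-rotate d f per)

  periodic-multiple : ∀ {d f} → Periodic d f → ∀ k i → f (k ℕ.* d ℕ.+ i) ≈ f i
  periodic-multiple         per zero    i = refl
  periodic-multiple {d} {f} per (suc k) i = trans
    (reflexive (cong f (ℕ.+-assoc d (k ℕ.* d) i)))
    (trans (per (k ℕ.* d ℕ.+ i)) (periodic-multiple per k i))

  %-periodic : ∀ d .{{_ : NonZero d}} f → Periodic d (λ i → f (i % d))
  %-periodic d f i = reflexive (cong f (≡.trans (cong (_% d) (ℕ.+-comm d i)) ([m+n]%n≡m%n i d)))

-- Units in a Heyting field

fieldRing : ∀ {c ℓ₁ ℓ₂} → HeytingField c ℓ₁ ℓ₂ → CommutativeRing c ℓ₁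
fieldRing F = HeytingCommutativeRing.commutativeRing (HeytingField.heytingCommutativeRing F)

module HeytingFacts {c ℓ₁ ℓ₂} (F : HeytingField c ℓ₁ ℓ₂) where

  open HeytingField F using (heytingCommutativeRing; #⇒invertible; tight)
  open HeytingCommutativeRing heytingCommutativeRing using (#-irrefl)
  open CommutativeRing (fieldRing F)
  open HeytingProperties heytingCommutativeRing using (1#0; x-0≈x)
  open ≈-Reasoning setoid

  IsUnit : Carrier → Set _
  IsUnit x = ∃[ y ] x * y ≈ 1#

  1≉0 : ¬ 1# ≈ 0#
  1≉0 1≈0 = #-irrefl 1≈0 1#0

  *-isUnit : ∀ {x y} → IsUnit x → IsUnit y → IsUnit (x * y)
  *-isUnit {x} {y} (x′ , xx′≈1) (y′ , yy′≈1) = x′ * y′ , (begin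
    (x * y) * (x′ * y′)  ≈⟨ CommutativeSemigroupProperties.interchange *-commutativeSemigroup x y x′ y′ ⟩
    (x * x′) * (y * y′)  ≈⟨ *-cong xx′≈1 yy′≈1 ⟩
    1# * 1#              ≈⟨ *-identityˡ 1# ⟩
    1#                   ∎)

  cancelˡ-unit : ∀ {x y z} → IsUnit x → x * y ≈ x * z → y ≈ z
  cancelˡ-unit {x} {y} {z} (x′ , xx′≈1) xy≈xz = begin
    y             ≈⟨ strip y ⟨
    x′ * (x * y)  ≈⟨ *-congˡ xy≈xz ⟩
    x′ * (x * z)  ≈⟨ strip z ⟩
    z             ∎
    where
    strip : ∀ w → x′ * (x * w) ≈ w
    strip w = begin
      x′ * (x * w)  ≈⟨ *-assoc x′ x w ⟨
      (x′ * x) * w  ≈⟨ *-congʳ (trans (*-comm x′ x) xx′≈1) ⟩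
      1# * w        ≈⟨ *-identityˡ w ⟩
      w             ∎

  unit≉0 : ∀ {x} → IsUnit x → ¬ x ≈ 0#
  unit≉0 (y , xy≈1) x≈0 = 1≉0 (trans (sym xy≈1) (trans (*-congʳ x≈0) (zeroˡ y)))

  -- An element apart from 0 is invertible, so a nonunit is not apart from 0, and tightness turns
  -- this into equality.
  nonunit≈0 : ∀ {x} → ¬ IsUnit x → x ≈ 0#
  nonunit≈0 {x} nonunit = proj₁ (tight x 0#) λ x#0 →
    let (y , _ , x-0*y≈1) = #⇒invertible x#0
    in nonunit (y , trans (*-congʳ (sym (x-0≈x x))) x-0*y≈1)

-- Finite fields: decidability of units, Fermat's identity, characteristic

module FiniteField {c ℓ₁ ℓ₂} (F : HeytingField c ℓ₁ ℓ₂) where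

  open CommutativeRing (fieldRing F)
  open HeytingFacts F
  open SemiringExp semiring using (_^_)
  open SemiringMult semiring using (×1-homo-*) renaming (_×_ to _×ᴺ_)
  open ≈-Reasoning setoid
  private
    module Add  = MonoidSum +-commutativeMonoid
    module Prod = MonoidSum *-commutativeMonoid

  -- Finiteness makes the case distinction constructive: an inverse is searched for among all
  -- elements.
  zero⊎unit : ∀ {q} → HasOrder F q → ∀ x → x ≈ 0# ⊎ IsUnit x
  zero⊎unit {q} fin x with any? (λ i → to (x * from i) ≟ᶠ to 1#)
    where open Inverse fin
  ... | yes (i , eq) = inj₂ (Inverse.from fin i ,
          trans (sym (inverseʳ ≡.refl)) (trans (from-cong eq) (inverseʳ ≡.refl)))
    where open Inverse fin
  ... | no none = inj₁ (nonunit≈0 λ (y , xy≈1) →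
          none (to y , to-cong (trans (*-congˡ (inverseʳ ≡.refl)) xy≈1)))
    where open Inverse fin

  -- Carries a bijection of the field over to the index set, so that sums and products over all
  -- elements can be reindexed along it.
  conjugate : ∀ {q} → HasOrder F q → (f g : Carrier → Carrier) →
    (∀ {x y} → x ≈ y → f x ≈ f y) → (∀ {x y} → x ≈ y → g x ≈ g y) →
    (∀ x → f (g x) ≈ x) → (∀ x → g (f x) ≈ x) → Permutation′ q
  conjugate fin f g f-cong g-cong fg gf = permutation
    (λ i → to (f (from i))) (λ i → to (g (from i)))
    (λ i → ≡.trans (to-cong (trans (f-cong (inverseʳ ≡.refl)) (fg (from i)))) (inverseˡ refl))
    (λ i → ≡.trans (to-cong (trans (g-cong (inverseʳ ≡.refl)) (gf (from i)))) (inverseˡ refl))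
    where open Inverse fin

  -- Translation by 1 permutes the field, so ∑ x = ∑ (x + 1).
  order×1≈0 : ∀ {q} → HasOrder F q → q ×ᴺ 1# ≈ 0#
  order×1≈0 {q} fin = RingProperties.+-cancelˡ ring total (q ×ᴺ 1#) 0# (begin
    total + q ×ᴺ 1#                        ≈⟨ +-congˡ (Add.sum-replicate q) ⟨
    total + Add.sum {q} (λ _ → 1#)         ≈⟨ Add.∑-distrib-+ {q} from (λ _ → 1#) ⟨
    Add.sum {q} (λ i → from i + 1#)        ≈⟨ Add.sum-cong-≋ {q} (λ i → inverseʳ ≡.refl) ⟨
    Add.sum {q} (λ i → from (π ⟨$⟩ʳ i))    ≈⟨ Add.sum-permute from π ⟨
    total                                  ≈⟨ +-identityʳ total ⟨
    total + 0#                             ∎)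
    where
    open Inverse fin
    total = Add.sum {q} from
    cancel : ∀ {y z} → y + z ≈ 0# → ∀ x → (x + y) + z ≈ x
    cancel y+z≈0 x = trans (+-assoc x _ _) (trans (+-congˡ y+z≈0) (+-identityʳ x))
    π = conjugate fin (_+ 1#) (_+ - 1#) +-congʳ +-congʳ
          (cancel (-‿inverseˡ 1#)) (cancel (-‿inverseʳ 1#))

  -- Multiplication by x ≉ 0 permutes the field; compare the products of all
  -- elements with 0 replaced by 1.
  fermat : ∀ {q} → HasOrder F q → ∀ x → x ^ q ≈ x
  fermat {zero}  fin x with () ← Inverse.to fin x
  fermat {suc q} fin x with zero⊎unit fin x
  ... | inj₁ x≈0 = trans (*-congʳ x≈0) (trans (zeroˡ (x ^ q)) (sym x≈0))
  ... | inj₂ x-unit@(x′ , xx′≈1) = begin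
    x * x ^ q  ≈⟨ *-congˡ x^q≈1 ⟩
    x * 1#     ≈⟨ *-identityʳ x ⟩
    x          ∎
    where
    open Inverse fin

    patch : Carrier → Carrier → Carrier
    patch y z with zero⊎unit fin z
    ... | inj₁ _ = 1#
    ... | inj₂ _ = y

    patch-zero : ∀ {y z} → z ≈ 0# → patch y z ≈ 1#
    patch-zero {y} {z} z≈0 with zero⊎unit fin z
    ... | inj₁ _ = refl
    ... | inj₂ z-unit = contradiction z≈0 (unit≉0 z-unit)

    patch-unit : ∀ {y z} → IsUnit z → patch y z ≈ y
    patch-unit {y} {z} z-unit with zero⊎unit fin z
    ... | inj₁ z≈0 = contradiction z≈0 (unit≉0 z-unit)
    ... | inj₂ _ = refl

    f : Carrier → Carrier
    f z = patch z z

    f-cong : ∀ {y z} → y ≈ z → f y ≈ f z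
    f-cong {y} {z} y≈z with zero⊎unit fin y
    ... | inj₁ y≈0 = sym (patch-zero (trans (sym y≈z) y≈0))
    ... | inj₂ (y′ , yy′≈1) = trans y≈z (sym (patch-unit (y′ , trans (*-congʳ (sym y≈z)) yy′≈1)))

    f-isUnit : ∀ z → IsUnit (f z)
    f-isUnit z with zero⊎unit fin z
    ... | inj₁ _ = 1# , *-identityˡ 1#
    ... | inj₂ z-unit = z-unit

    -- At z = 0 both `f` values are the replacement 1, so the scaling factor there is 1 instead of
    -- x; `patch x z` records this.
    f-scale : ∀ z → f (x * z) ≈ f z * patch x z
    f-scale z with zero⊎unit fin z
    ... | inj₁ z≈0    = trans (patch-zero (trans (*-congˡ z≈0) (zeroʳ x))) (sym (*-identityˡ 1#))
    ... | inj₂ z-unit = trans (patch-unit (*-isUnit x-unit z-unit)) (*-comm x z)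

    product-isUnit : ∀ {k} (t : Vector Carrier k) → (∀ i → IsUnit (t i)) → IsUnit (Prod.sum t)
    product-isUnit {zero}  t units = 1# , *-identityˡ 1#
    product-isUnit {suc k} t units =
      *-isUnit (units Fin.zero) (product-isUnit (λ i → t (Fin.suc i)) (λ i → units (Fin.suc i)))

    scale-cancel : ∀ {y z} → y * z ≈ 1# → ∀ w → y * (z * w) ≈ w
    scale-cancel yz≈1 w = trans (sym (*-assoc _ _ w)) (trans (*-congʳ yz≈1) (*-identityˡ w))

    π = conjugate fin (x *_) (x′ *_) *-congˡ *-congˡ
          (scale-cancel xx′≈1) (scale-cancel (trans (*-comm x′ x) xx′≈1))

    P = Prod.sum (λ i → f (from i))

    product-patch≈1 : Prod.sum (λ i → patch x (from i)) ≈ 1#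
    product-patch≈1 = cancelˡ-unit (product-isUnit _ (λ i → f-isUnit (from i))) (begin
      P * Prod.sum (λ i → patch x (from i))          ≈⟨ Prod.∑-distrib-+ (λ i → f (from i)) (λ i → patch x (from i)) ⟨
      Prod.sum (λ i → f (from i) * patch x (from i)) ≈⟨ Prod.sum-cong-≋ {suc q} (λ i → f-scale (from i)) ⟨
      Prod.sum (λ i → f (x * from i))                ≈⟨ Prod.sum-cong-≋ {suc q} (λ i → f-cong (inverseʳ {x * from i} ≡.refl)) ⟨
      Prod.sum (λ i → f (from (π ⟨$⟩ʳ i)))           ≈⟨ Prod.sum-permute (λ i → f (from i)) π ⟨
      P                                              ≈⟨ *-identityʳ P ⟨
      P * 1#                                         ∎)

    others-unit : ∀ i → IsUnit (from (punchIn (to 0#) i))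
    others-unit i with zero⊎unit fin (from (punchIn (to 0#) i))
    ... | inj₂ unit = unit
    ... | inj₁ ≈0   = contradiction (≡.trans (≡.sym (inverseˡ refl)) (to-cong ≈0)) (punchInᵢ≢i (to 0#) i)

    -- The field has `suc q` elements. Dropping the index of 0, whose factor is 1, leaves q factors
    -- equal to x.
    x^q≈1 : x ^ q ≈ 1#
    x^q≈1 = begin
      x ^ q                                                    ≈⟨ Prod.sum-replicate q ⟨
      Prod.sum {q} (λ _ → x)                                   ≈⟨ Prod.sum-cong-≋ (λ i → patch-unit (others-unit i)) ⟨
      Prod.sum (removeAt (λ i → patch x (from i)) (to 0#))     ≈⟨ *-identityˡ _ ⟨
      1# * Prod.sum (removeAt (λ i → patch x (from i)) (to 0#)) ≈⟨ *-congʳ (patch-zero (inverseʳ ≡.refl)) ⟨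
      patch x (from (to 0#)) * Prod.sum (removeAt (λ i → patch x (from i)) (to 0#))
        ≈⟨ Prod.sum-remove {q} {to 0#} (λ i → patch x (from i)) ⟨
      Prod.sum (λ i → patch x (from i))                        ≈⟨ product-patch≈1 ⟩
      1#                                                       ∎

  -- If 1 + 1 were a unit, so would be its n-th power, which is the 2ⁿ-fold multiple of 1 and hence
  -- 0.
  characteristic2 : ∀ {n} → HasOrder F (2 ℕ.^ n) → 1# + 1# ≈ 0#
  characteristic2 {n} fin with zero⊎unit fin (1# + 1#)
  ... | inj₁ 2≈0 = 2≈0
  ... | inj₂ 2-unit = contradiction (trans (sym (cast n)) (order×1≈0 fin)) (unit≉0 (power-isUnit n))
    where
    power-isUnit : ∀ k → IsUnit ((1# + 1#) ^ k)
    power-isUnit zero    = 1# , *-identityˡ 1#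
    power-isUnit (suc k) = *-isUnit 2-unit (power-isUnit k)

    cast : ∀ k → (2 ℕ.^ k) ×ᴺ 1# ≈ (1# + 1#) ^ k
    cast zero    = +-identityʳ 1#
    cast (suc k) = trans (×1-homo-* 2 (2 ℕ.^ k)) (*-cong (+-congˡ (+-identityʳ 1#)) (cast k))

-- Correlations of periodic sequences and sums over residue classes

m∸n+[m+n]≡1*[m+m] : ∀ {m n} → n ≤ m → (m ∸ n) ℕ.+ (m ℕ.+ n) ≡ 1 ℕ.* (m ℕ.+ m)
m∸n+[m+n]≡1*[m+m] {m} {n} n≤m = begin
  (m ∸ n) ℕ.+ (m ℕ.+ n)  ≡⟨ cong ((m ∸ n) ℕ.+_) (ℕ.+-comm m n) ⟩
  (m ∸ n) ℕ.+ (n ℕ.+ m)  ≡⟨ ℕ.+-assoc (m ∸ n) n m ⟨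
  (m ∸ n) ℕ.+ n ℕ.+ m    ≡⟨ cong (ℕ._+ m) (ℕ.m∸n+n≡m n≤m) ⟩
  m ℕ.+ m                ≡⟨ ℕ.*-identityˡ (m ℕ.+ m) ⟨
  1 ℕ.* (m ℕ.+ m)        ∎
  where open ≡.≡-Reasoning

module Correlations {c ℓ} (R : CommutativeRing c ℓ) where

  open CommutativeRing R
  open RangeSums +-commutativeMonoid
  open ≈-Reasoning setoid

  HasCharacteristic2 : Set ℓ
  HasCharacteristic2 = 1# + 1# ≈ 0#

  *-distribˡ-sumTo : ∀ n x f → x * sumTo n f ≈ sumTo n (λ i → x * f i)
  *-distribˡ-sumTo zero    x f = zeroʳ x
  *-distribˡ-sumTo (suc n) x f =
    trans (distribˡ x (f 0) _) (+-congˡ (*-distribˡ-sumTo n x (λ i → f (suc i))))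

  *-distribʳ-sumTo : ∀ n x f → sumTo n f * x ≈ sumTo n (λ i → f i * x)
  *-distribʳ-sumTo n x f = trans (*-comm _ x)
    (trans (*-distribˡ-sumTo n x f) (sumTo-cong n (λ i → *-comm x (f i))))

  -- The cyclic cross-correlation at shift k when u and v have period d.
  correlation : ℕ → (ℕ → Carrier) → (ℕ → Carrier) → ℕ → Carrier
  correlation d u v k = sumTo d (λ r → u r * v (k ℕ.+ r))

  -- The sum over one residue class modulo d. For the conjugates of α and n = q d it is the relative
  -- trace of α^(2ᵏ) to the subfield of degree d.
  class-sum : ℕ → ℕ → (ℕ → Carrier) → ℕ → Carrier
  class-sum q d u k = sumTo q (λ i → u (i ℕ.* d ℕ.+ k))

  periodic-+ : ∀ {d u} → Periodic d u → ∀ k → Periodic d (λ i → u (k ℕ.+ i))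
  periodic-+ {d} {u} per k i = trans
    (reflexive (cong u (solve 3 (λ k d i → k :+ (d :+ i) := d :+ (k :+ i)) ≡.refl k d i)))
    (per (k ℕ.+ i))
    where open +-*-Solver

  correlation-periodic : ∀ n d u {v} → Periodic d v → Periodic d (correlation n u v)
  correlation-periodic n d u {v} per k = sumTo-cong n λ r → *-congˡ
    (trans (reflexive (cong v (ℕ.+-assoc d k r))) (per (k ℕ.+ r)))

  -- Replacing k by d + k rotates the index i by one step, and i ↦ u (i d + k) has period q.
  class-sum-periodic : ∀ {n} q d {u} → n ≡ q ℕ.* d → Periodic n u → Periodic d (class-sum q d u)
  class-sum-periodic q d {u} ≡.refl per k = begin
    sumTo q (λ i → u (i ℕ.* d ℕ.+ (d ℕ.+ k)))
      ≈⟨ sumTo-cong q (λ i → reflexive (cong u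
           (solve 3 (λ i d k → i :* d :+ (d :+ k) := (con 1 :+ i) :* d :+ k) ≡.refl i d k))) ⟩
    sumTo q (λ i → u (suc i ℕ.* d ℕ.+ k))
      ≈⟨ sumTo-rotate q (λ i → u (i ℕ.* d ℕ.+ k)) (λ i → trans
           (reflexive (cong u (solve 4 (λ q i d k → (q :+ i) :* d :+ k := q :* d :+ (i :* d :+ k)) ≡.refl q i d k)))
           (per (i ℕ.* d ℕ.+ k))) ⟩
    sumTo q (λ i → u (i ℕ.* d ℕ.+ k)) ∎
    where open +-*-Solver

  sumTo-class-sum : ∀ {n} q d f → n ≡ q ℕ.* d → sumTo d (class-sum q d f) ≈ sumTo n f
  sumTo-class-sum q d f ≡.refl = trans (sumTo-swap d q _) (sym (sumTo-blocks q d f))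

  correlation-class-sumʳ : ∀ n q d u k →
    class-sum q d (correlation n u u) k ≈ correlation n u (class-sum q d u) k
  correlation-class-sumʳ n q d u k = begin
    sumTo q (λ i → sumTo n (λ t → u t * u (i ℕ.* d ℕ.+ k ℕ.+ t)))
      ≈⟨ sumTo-swap q n _ ⟩
    sumTo n (λ t → sumTo q (λ i → u t * u (i ℕ.* d ℕ.+ k ℕ.+ t)))
      ≈⟨ sumTo-cong n (λ t → sumTo-cong q (λ i → *-congˡ (reflexive (cong u (ℕ.+-assoc (i ℕ.* d) k t))))) ⟩
    sumTo n (λ t → sumTo q (λ i → u t * u (i ℕ.* d ℕ.+ (k ℕ.+ t))))
      ≈⟨ sumTo-cong n (λ t → *-distribˡ-sumTo q (u t) _) ⟨
    correlation n u (class-sum q d u) k ∎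

  -- The n indices are grouped by their residue modulo d; the factor from v depends on the residue
  -- only and comes out of each group.
  correlation-class-sumˡ : ∀ {n} q d u {v} → n ≡ q ℕ.* d → Periodic d v → ∀ k →
    correlation n u v k ≈ correlation d (class-sum q d u) v k
  correlation-class-sumˡ q d u {v} ≡.refl per k = begin
    sumTo (q ℕ.* d) (λ t → u t * v (k ℕ.+ t))
      ≈⟨ sumTo-blocks q d _ ⟩
    sumTo q (λ i → sumTo d (λ r → u (i ℕ.* d ℕ.+ r) * v (k ℕ.+ (i ℕ.* d ℕ.+ r))))
      ≈⟨ sumTo-cong q (λ i → sumTo-cong d (λ r → *-congˡ (periodic-multiple (periodic-+ per k) i r))) ⟩
    sumTo q (λ i → sumTo d (λ r → u (i ℕ.* d ℕ.+ r) * v (k ℕ.+ r)))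
      ≈⟨ sumTo-swap q d _ ⟩
    sumTo d (λ r → sumTo q (λ i → u (i ℕ.* d ℕ.+ r) * v (k ℕ.+ r)))
      ≈⟨ sumTo-cong d (λ r → *-distribʳ-sumTo q (v (k ℕ.+ r)) _) ⟨
    correlation d (class-sum q d u) v k ∎

  -- The outer sum first moves into the second factor. That factor then has period d, so the first
  -- factor can be folded too.
  class-sum-correlation : ∀ {n} q d {u} → n ≡ q ℕ.* d → Periodic n u → ∀ k →
    class-sum q d (correlation n u u) k
      ≈ correlation d (class-sum q d u) (class-sum q d u) k
  class-sum-correlation {n} q d {u} n≡qd per k = trans
    (correlation-class-sumʳ n q d u k)
    (correlation-class-sumˡ q d u n≡qd (class-sum-periodic q d n≡qd per) k)

  *-periodic : ∀ {d u v} → Periodic d u → Periodic d v → Periodic d (λ i → u i * v i)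
  *-periodic per-u per-v i = *-cong (per-u i) (per-v i)

  -- Reflection of the shift k to -k, with l in the role of -k modulo d: substituting l + r for r
  -- moves the shift to the other factor.
  correlation-reflect : ∀ d {u v} → Periodic d u → Periodic d v → ∀ k l j → k ℕ.+ l ≡ j ℕ.* d →
    correlation d u v k ≈ correlation d v u l
  correlation-reflect d {u} {v} per-u per-v k l j k+l≡jd = begin
    sumTo d (λ r → u r * v (k ℕ.+ r))
      ≈⟨ sumTo-shift d _ (*-periodic per-u (periodic-+ per-v k)) l ⟨
    sumTo d (λ r → u (l ℕ.+ r) * v (k ℕ.+ (l ℕ.+ r)))
      ≈⟨ sumTo-cong d (λ r → *-congˡ (trans
           (reflexive (cong v (≡.trans (≡.sym (ℕ.+-assoc k l r)) (cong (ℕ._+ r) k+l≡jd))))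
           (periodic-multiple per-v j r))) ⟩
    sumTo d (λ r → u (l ℕ.+ r) * v r)
      ≈⟨ sumTo-cong d (λ r → *-comm _ _) ⟩
    correlation d v u l ∎

  -- For fixed r, letting the shift run over a period makes the second factor run over a whole
  -- period.
  sumTo-correlation : ∀ d u {v} → Periodic d v →
    sumTo d (correlation d u v) ≈ sumTo d u * sumTo d v
  sumTo-correlation d u {v} per = begin
    sumTo d (λ l → sumTo d (λ r → u r * v (l ℕ.+ r)))
      ≈⟨ sumTo-swap d d _ ⟩
    sumTo d (λ r → sumTo d (λ l → u r * v (l ℕ.+ r)))
      ≈⟨ sumTo-cong d (λ r → *-distribˡ-sumTo d (u r) _) ⟨
    sumTo d (λ r → u r * sumTo d (λ l → v (l ℕ.+ r)))
      ≈⟨ sumTo-cong d (λ r → *-congˡ (trans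
           (sumTo-cong d (λ l → reflexive (cong v (ℕ.+-comm l r)))) (sumTo-shift d v per r))) ⟩
    sumTo d (λ r → u r * sumTo d v)
      ≈⟨ *-distribʳ-sumTo d (sumTo d v) u ⟨
    sumTo d u * sumTo d v ∎

  -- The second summand with shift suc l is the first one with shift 2 M − 1 − l,
  -- so the left-hand side runs over all M + M shifts.
  sumTo-half-correlations : ∀ M {u v} → Periodic (M ℕ.+ M) u → Periodic (M ℕ.+ M) v →
    sumTo M (λ l → correlation (M ℕ.+ M) u v l + correlation (M ℕ.+ M) v u (suc l))
      ≈ sumTo (M ℕ.+ M) u * sumTo (M ℕ.+ M) v
  sumTo-half-correlations M {u} {v} per-u per-v = begin
    sumTo M (λ l → uv l + vu (suc l))
      ≈⟨ sumTo-∙ M uv (λ l → vu (suc l)) ⟩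
    sumTo M uv + sumTo M (λ l → vu (suc l))
      ≈⟨ +-congˡ (sumTo-reverse M vu) ⟩
    sumTo M uv + sumTo M (λ l → vu (M ∸ l))
      ≈⟨ +-congˡ (sumTo-cong-< M (λ l l<M →
           correlation-reflect h per-v per-u (M ∸ l) (M ℕ.+ l) 1 (m∸n+[m+n]≡1*[m+m] (ℕ.<⇒≤ l<M)))) ⟩
    sumTo M uv + sumTo M (λ l → uv (M ℕ.+ l))
      ≈⟨ sumTo-++ M M uv ⟨
    sumTo h uv
      ≈⟨ sumTo-correlation h u per-v ⟩
    sumTo h u * sumTo h v ∎
    where
    h = M ℕ.+ M
    uv = correlation h u v
    vu = correlation h v u

  -- An odd shift exchanges the parities of indices: 2r goes to 2(l + r) + 1, and 2r + 1 goes to 2(l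
  -- + 1 + r). The second case accounts for the shift `suc l`.
  correlation-even-odd : ∀ h u l →
    correlation (h ℕ.* 2) u u (suc (l ℕ.* 2))
      ≈ correlation h (λ i → u (i ℕ.* 2)) (λ i → u (suc (i ℕ.* 2))) l
        + correlation h (λ i → u (suc (i ℕ.* 2))) (λ i → u (i ℕ.* 2)) (suc l)
  correlation-even-odd h u l = trans
    (sumTo-even-odd h (λ r → u r * u (suc (l ℕ.* 2) ℕ.+ r)))
    (+-cong
      (sumTo-cong h (λ r → *-congˡ (reflexive (cong u
        (solve 2 (λ l r → con 1 :+ l :* con 2 :+ r :* con 2 := con 1 :+ (l :+ r) :* con 2) ≡.refl l r)))))
      (sumTo-cong h (λ r → *-congˡ (reflexive (cong u
        (solve 2 (λ l r → con 1 :+ l :* con 2 :+ (con 1 :+ r :* con 2) := (con 1 :+ l :+ r) :* con 2) ≡.refl l r))))))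
    where open +-*-Solver

-- Frobenius orbits in characteristic 2

module Characteristic2 {c ℓ} (R : CommutativeRing c ℓ)
  (1+1≈0 : Correlations.HasCharacteristic2 R) where

  open CommutativeRing R
  open RangeSums +-commutativeMonoid
  open Correlations R
  open CommutativeSemigroupProperties *-commutativeSemigroup
    using () renaming (interchange to *-interchange)
  open ≈-Reasoning setoid

  x+x≈0 : ∀ x → x + x ≈ 0#
  x+x≈0 x = begin
    x + x            ≈⟨ +-cong (*-identityʳ x) (*-identityʳ x) ⟨
    x * 1# + x * 1#  ≈⟨ distribˡ x 1# 1# ⟨
    x * (1# + 1#)    ≈⟨ *-congˡ 1+1≈0 ⟩
    x * 0#           ≈⟨ zeroʳ x ⟩
    0#               ∎

  x+[x+y]≈y : ∀ x y → x + (x + y) ≈ y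
  x+[x+y]≈y x y = trans (sym (+-assoc x x y)) (trans (+-congʳ (x+x≈0 x)) (+-identityˡ y))

  square-+ : ∀ x y → (x + y) * (x + y) ≈ x * x + y * y
  square-+ x y = begin
    (x + y) * (x + y)                  ≈⟨ distribˡ (x + y) x y ⟩
    (x + y) * x + (x + y) * y          ≈⟨ +-cong (distribʳ x x y) (distribʳ y x y) ⟩
    (x * x + y * x) + (x * y + y * y)  ≈⟨ +-congʳ (+-congˡ (*-comm y x)) ⟩
    (x * x + x * y) + (x * y + y * y)  ≈⟨ +-assoc (x * x) _ _ ⟩
    x * x + (x * y + (x * y + y * y))  ≈⟨ +-congˡ (x+[x+y]≈y (x * y) (y * y)) ⟩
    x * x + y * y                      ∎

  square-sumTo : ∀ n f → sumTo n f * sumTo n f ≈ sumTo n (λ i → f i * f i)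
  square-sumTo zero    f = zeroˡ 0#
  square-sumTo (suc n) f = trans (square-+ (f 0) _) (+-congˡ (square-sumTo n (λ i → f (suc i))))

  -- Says that u j is the 2ʲ-th power of u 0, in an exponent-free form from which closure under
  -- products and sums follows directly.
  FrobeniusOrbit : (ℕ → Carrier) → Set ℓ
  FrobeniusOrbit u = ∀ j → u (suc j) ≈ u j * u j

  orbit-unique : ∀ {u v} → FrobeniusOrbit u → FrobeniusOrbit v → u 0 ≈ v 0 → ∀ j → u j ≈ v j
  orbit-unique orb-u orb-v u₀≈v₀ zero    = u₀≈v₀
  orbit-unique orb-u orb-v u₀≈v₀ (suc j) =
    let uⱼ≈vⱼ = orbit-unique orb-u orb-v u₀≈v₀ j
    in trans (orb-u j) (trans (*-cong uⱼ≈vⱼ uⱼ≈vⱼ) (sym (orb-v j)))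

  *-orbit : ∀ {u v} → FrobeniusOrbit u → FrobeniusOrbit v → FrobeniusOrbit (λ j → u j * v j)
  *-orbit orb-u orb-v j = trans (*-cong (orb-u j) (orb-v j)) (*-interchange _ _ _ _)

  class-sum-orbit : ∀ q d {u} → FrobeniusOrbit u → FrobeniusOrbit (class-sum q d u)
  class-sum-orbit q d {u} orb k = begin
    sumTo q (λ i → u (i ℕ.* d ℕ.+ suc k))
      ≈⟨ sumTo-cong q (λ i → trans (reflexive (cong u (ℕ.+-suc (i ℕ.* d) k))) (orb (i ℕ.* d ℕ.+ k))) ⟩
    sumTo q (λ i → u (i ℕ.* d ℕ.+ k) * u (i ℕ.* d ℕ.+ k))
      ≈⟨ square-sumTo q (λ i → u (i ℕ.* d ℕ.+ k)) ⟨
    class-sum q d u k * class-sum q d u k ∎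

  -- Along an orbit squaring is the shift, so the sum of squares is a rotation of the sum.
  correlation-0 : ∀ d {u} → FrobeniusOrbit u → Periodic d u → correlation d u u 0 ≈ sumTo d u
  correlation-0 d {u} orb per = trans (sumTo-cong d (λ r → sym (orb r))) (sumTo-rotate d u per)

  -- The terms at r and h + r have the same two factors in opposite order, so the two halves of the
  -- sum cancel.
  correlation-half : ∀ {d} h {u} → d ≡ h ℕ.+ h → Periodic d u → correlation d u u h ≈ 0#
  correlation-half h {u} ≡.refl per = begin
    sumTo (h ℕ.+ h) (λ r → u r * u (h ℕ.+ r))
      ≈⟨ sumTo-++ h h _ ⟩
    half + sumTo h (λ r → u (h ℕ.+ r) * u (h ℕ.+ (h ℕ.+ r)))
      ≈⟨ +-congˡ (sumTo-cong h (λ r → trans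
           (*-congˡ (trans (reflexive (cong u (≡.sym (ℕ.+-assoc h h r)))) (per r)))
           (*-comm _ _))) ⟩
    half + half
      ≈⟨ x+x≈0 half ⟩
    0# ∎
    where half = sumTo h (λ r → u r * u (h ℕ.+ r))

  -- With γ = ∑ u₂ᵣ the left-hand side is γ γ², where γ + γ² = ∑ uᵣ = 1.
  sumTo-odd-correlations : ∀ {d} M {u} → d ≡ (M ℕ.+ M) ℕ.* 2 →
    FrobeniusOrbit u → Periodic d u → sumTo d u ≈ 1# →
    sumTo M (λ l → correlation d u u (suc (l ℕ.* 2))) ≈ 1#
  sumTo-odd-correlations M {u} ≡.refl orb per total≈1 = begin
    sumTo M (λ l → correlation (h ℕ.* 2) u u (suc (l ℕ.* 2)))
      ≈⟨ sumTo-cong M (correlation-even-odd h u) ⟩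
    sumTo M (λ l → correlation h even odd l + correlation h odd even (suc l))
      ≈⟨ sumTo-half-correlations M even-periodic odd-periodic ⟩
    γ * sumTo h odd
      ≈⟨ *-congˡ odd≈1+γ ⟩
    γ * (1# + γ)
      ≈⟨ trans (distribˡ γ 1# γ) (+-cong (*-identityʳ γ) (square-sumTo h even)) ⟩
    γ + sumTo h (λ r → even r * even r)
      ≈⟨ +-congˡ (sumTo-cong h (λ r → sym (orb (r ℕ.* 2)))) ⟩
    γ + sumTo h odd
      ≈⟨ γ+odd≈1 ⟩
    1# ∎
    where
    h = M ℕ.+ M
    even odd : ℕ → Carrier
    even r = u (r ℕ.* 2)
    odd  r = u (suc (r ℕ.* 2))
    γ = sumTo h even
    even-periodic : Periodic h even
    even-periodic i = trans (reflexive (cong u (ℕ.*-distribʳ-+ 2 h i))) (per (i ℕ.* 2))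
    odd-periodic : Periodic h odd
    odd-periodic i = trans
      (reflexive (cong u (≡.trans (cong suc (ℕ.*-distribʳ-+ 2 h i)) (≡.sym (ℕ.+-suc (h ℕ.* 2) (i ℕ.* 2))))))
      (per (suc (i ℕ.* 2)))
    γ+odd≈1 : γ + sumTo h odd ≈ 1#
    γ+odd≈1 = trans (sym (sumTo-even-odd h u)) total≈1
    odd≈1+γ : sumTo h odd ≈ 1# + γ
    odd≈1+γ = begin
      sumTo h odd            ≈⟨ x+[x+y]≈y γ _ ⟨
      γ + (γ + sumTo h odd)  ≈⟨ +-congˡ γ+odd≈1 ⟩
      γ + 1#                 ≈⟨ +-comm γ 1# ⟩
      1# + γ                 ∎

-- The action of 𝔽₂[x] on sequences, with x acting as the shift

module PolynomialAction {c ℓ₁ ℓ₂} (F : HeytingField c ℓ₁ ℓ₂)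
  (1+1≈0 : Correlations.HasCharacteristic2 (fieldRing F)) where

  open CommutativeRing (fieldRing F)
  open HeytingFacts F using (1≉0)
  open RangeSums +-commutativeMonoid
  open Characteristic2 (fieldRing F) 1+1≈0
  open CommutativeSemigroupProperties *-commutativeSemigroup
    using () renaming (interchange to *-interchange; x∙yz≈y∙xz to x*yz≈y*xz)
  open CommutativeSemigroupProperties +-commutativeSemigroup
    using () renaming (interchange to +-interchange)
  open ≈-Reasoning setoid

  ⟦_⟧ : Parity → Carrier
  ⟦_⟧ = ι F

  ι-+ : ∀ a b → ⟦ a ℙ.+ b ⟧ ≈ ⟦ a ⟧ + ⟦ b ⟧
  ι-+ 0ℙ b  = sym (+-identityˡ ⟦ b ⟧)
  ι-+ 1ℙ 0ℙ = sym (+-identityʳ 1#)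
  ι-+ 1ℙ 1ℙ = sym 1+1≈0

  ι-* : ∀ a b → ⟦ a ℙ.* b ⟧ ≈ ⟦ a ⟧ * ⟦ b ⟧
  ι-* 0ℙ b = sym (zeroˡ ⟦ b ⟧)
  ι-* 1ℙ b = sym (*-identityˡ ⟦ b ⟧)

  ι-injective : ∀ {a b} → ⟦ a ⟧ ≈ ⟦ b ⟧ → a ≡ b
  ι-injective {0ℙ} {0ℙ} _   = ≡.refl
  ι-injective {0ℙ} {1ℙ} 0≈1 = contradiction (sym 0≈1) 1≉0
  ι-injective {1ℙ} {0ℙ} 1≈0 = contradiction 1≈0 1≉0
  ι-injective {1ℙ} {1ℙ} _   = ≡.refl

  ι-sum : ∀ {k} (t : Vector Parity k) (f : ℕ → Carrier) →
    (∀ i → ⟦ t i ⟧ ≈ f (toℕ i)) → ⟦ sum t ⟧ ≈ sumTo k f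
  ι-sum {zero}  t f t≈f = refl
  ι-sum {suc k} t f t≈f = trans (ι-+ (t Fin.zero) _)
    (+-cong (t≈f Fin.zero) (ι-sum (λ i → t (Fin.suc i)) (λ i → f (suc i)) (λ i → t≈f (Fin.suc i))))

  infixr 7 _•_
  -- The value at j is the sum of all cᵢ u (i + j), where cᵢ is the coefficient of xⁱ; this makes
  -- sequences a module over 𝔽₂[x].
  _•_ : Poly → (ℕ → Carrier) → ℕ → Carrier
  ([]      • u) j = 0#
  ((c ∷ p) • u) j = ⟦ c ⟧ * u j + (p • u) (suc j)

  •-cong : ∀ p {u v} → (∀ i → u i ≈ v i) → ∀ j → (p • u) j ≈ (p • v) j
  •-cong []      u≈v j = refl
  •-cong (c ∷ p) u≈v j = +-cong (*-congˡ (u≈v j)) (•-cong p u≈v (suc j))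

  zero-• : ∀ p u → (∀ i → coeff p i ≡ 0ℙ) → ∀ j → (p • u) j ≈ 0#
  zero-• []      u p≡0 j = refl
  zero-• (c ∷ p) u p≡0 j = begin
    ⟦ c ⟧ * u j + (p • u) (suc j)
      ≈⟨ +-cong (*-congʳ (reflexive (cong ⟦_⟧ (p≡0 0)))) (zero-• p u (λ i → p≡0 (suc i)) (suc j)) ⟩
    0# * u j + 0#
      ≈⟨ trans (+-identityʳ _) (zeroˡ (u j)) ⟩
    0# ∎

  •-congʳ : ∀ p q u → p ≈ₚ q → ∀ j → (p • u) j ≈ (q • u) j
  •-congʳ []      q       u p≈q j = sym (zero-• q u (λ i → ≡.sym (p≈q i)) j)
  •-congʳ (c ∷ p) []      u p≈q j = zero-• (c ∷ p) u p≈q j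
  •-congʳ (c ∷ p) (d ∷ q) u p≈q j =
    +-cong (*-congʳ (reflexive (cong ⟦_⟧ (p≈q 0)))) (•-congʳ p q u (λ i → p≈q (suc i)) (suc j))

  •-shift : ∀ p u k j → (p • (λ i → u (k ℕ.+ i))) j ≈ (p • u) (k ℕ.+ j)
  •-shift []      u k j = refl
  •-shift (c ∷ p) u k j = +-congˡ (trans (•-shift p u k (suc j)) (reflexive (cong (p • u) (ℕ.+-suc k j))))

  •-zero : ∀ p j → (p • (λ _ → 0#)) j ≈ 0#
  •-zero []      j = refl
  •-zero (c ∷ p) j = trans (+-cong (zeroʳ ⟦ c ⟧) (•-zero p (suc j))) (+-identityˡ 0#)

  •-+ : ∀ p u v j → (p • (λ i → u i + v i)) j ≈ (p • u) j + (p • v) j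
  •-+ []      u v j = sym (+-identityˡ 0#)
  •-+ (c ∷ p) u v j =
    trans (+-cong (distribˡ ⟦ c ⟧ (u j) (v j)) (•-+ p u v (suc j))) (+-interchange _ _ _ _)

  •-* : ∀ p a u j → (p • (λ i → a * u i)) j ≈ a * (p • u) j
  •-* []      a u j = sym (zeroʳ a)
  •-* (c ∷ p) a u j =
    trans (+-cong (x*yz≈y*xz ⟦ c ⟧ a (u j)) (•-* p a u (suc j))) (sym (distribˡ a _ _))

  •-sumTo : ∀ p n (u : ℕ → ℕ → Carrier) j →
    (p • (λ i → sumTo n (λ t → u t i))) j ≈ sumTo n (λ t → (p • u t) j)
  •-sumTo p zero    u j = •-zero p j
  •-sumTo p (suc n) u j = trans (•-+ p (u 0) _ j) (+-congˡ (•-sumTo p n (λ t → u (suc t)) j))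

  +ₚ-• : ∀ p q u j → ((p +ₚ q) • u) j ≈ (p • u) j + (q • u) j
  +ₚ-• []      q       u j = sym (+-identityˡ _)
  +ₚ-• (c ∷ p) []      u j = sym (+-identityʳ _)
  +ₚ-• (c ∷ p) (d ∷ q) u j = trans
    (+-cong (trans (*-congʳ (ι-+ c d)) (distribʳ (u j) ⟦ c ⟧ ⟦ d ⟧)) (+ₚ-• p q u (suc j)))
    (+-interchange _ _ _ _)

  scale-• : ∀ c q u j → (List.map (c ℙ.*_) q • u) j ≈ ⟦ c ⟧ * (q • u) j
  scale-• c []      u j = sym (zeroʳ ⟦ c ⟧)
  scale-• c (d ∷ q) u j = trans
    (+-cong (trans (*-congʳ (ι-* c d)) (*-assoc ⟦ c ⟧ ⟦ d ⟧ (u j))) (scale-• c q u (suc j)))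
    (sym (distribˡ ⟦ c ⟧ _ _))

  *ₚ-• : ∀ p q u j → ((p *ₚ q) • u) j ≈ (p • (q • u)) j
  *ₚ-• []      q u j = refl
  *ₚ-• (c ∷ p) q u j = trans (+ₚ-• (List.map (c ℙ.*_) q) (0ℙ ∷ (p *ₚ q)) u j)
    (+-cong (scale-• c q u j)
      (trans (+-congʳ (zeroˡ (u j))) (trans (+-identityˡ _) (*ₚ-• p q u (suc j)))))

  -- By linearity and shift invariance, the action of q commutes with scalars and with the shift,
  -- out of which p is built.
  •-comm : ∀ p q u j → (p • (q • u)) j ≈ (q • (p • u)) j
  •-comm []      q u j = sym (•-zero q j)
  •-comm (c ∷ p) q u j = begin
    ⟦ c ⟧ * (q • u) j + (p • (q • u)) (suc j)
      ≈⟨ +-cong (sym (•-* q ⟦ c ⟧ u j)) (trans (•-comm p q u (suc j)) (sym (•-shift q (p • u) 1 j))) ⟩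
    (q • (λ i → ⟦ c ⟧ * u i)) j + (q • (λ i → (p • u) (suc i))) j
      ≈⟨ •-+ q _ _ j ⟨
    (q • ((c ∷ p) • u)) j ∎

  -- Squaring is additive, commutes with the shift along the orbit and fixes the coefficients, which
  -- lie in 𝔽₂.
  •-orbit : ∀ p {u} → FrobeniusOrbit u → FrobeniusOrbit (p • u)
  •-orbit []      orb j = sym (zeroˡ 0#)
  •-orbit (c ∷ p) {u} orb j = trans
    (+-cong (trans (*-cong (sym (ι-idem c)) (orb j)) (*-interchange ⟦ c ⟧ ⟦ c ⟧ (u j) (u j)))
            (•-orbit p orb (suc j)))
    (sym (square-+ (⟦ c ⟧ * u j) ((p • u) (suc j))))
    where
    ι-idem : ∀ c → ⟦ c ⟧ * ⟦ c ⟧ ≈ ⟦ c ⟧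
    ι-idem c = trans (sym (ι-* c c)) (reflexive (cong ⟦_⟧ (ℙ.*-idem c)))

  •-periodic : ∀ p {d u} → Periodic d u → Periodic d (p • u)
  •-periodic p {d} {u} per j = trans (sym (•-shift p u d j)) (•-cong p per j)

  1ₚ-• : ∀ u j → (1ₚ • u) j ≈ u j
  1ₚ-• u j = trans (+-identityʳ _) (*-identityˡ (u j))

  X-• : ∀ u j → (X • u) j ≈ u (suc j)
  X-• u j = trans (+-cong (zeroˡ (u j)) (1ₚ-• u (suc j))) (+-identityˡ _)

  X^-• : ∀ k u j → ((X ^ₚ k) • u) j ≈ u (k ℕ.+ j)
  X^-• zero    u j = 1ₚ-• u j
  X^-• (suc k) u j = begin
    ((X *ₚ X ^ₚ k) • u) j   ≈⟨ *ₚ-• X (X ^ₚ k) u j ⟩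
    (X • (X ^ₚ k • u)) j    ≈⟨ X-• (X ^ₚ k • u) j ⟩
    ((X ^ₚ k) • u) (suc j)  ≈⟨ X^-• k u (suc j) ⟩
    u (k ℕ.+ suc j)         ≈⟨ reflexive (cong u (ℕ.+-suc k j)) ⟩
    u (suc k ℕ.+ j)         ∎

  X^-1-• : ∀ k u j → ((X ^ₚ k -ₚ 1ₚ) • u) j ≈ u (k ℕ.+ j) + u j
  X^-1-• k u j = trans (+ₚ-• (X ^ₚ k) 1ₚ u j) (+-cong (X^-• k u j) (1ₚ-• u j))

  X^-1-•-periodic : ∀ k {u} → Periodic k u → ∀ j → ((X ^ₚ k -ₚ 1ₚ) • u) j ≈ 0#
  X^-1-•-periodic k {u} per j = trans (X^-1-• k u j) (trans (+-congʳ (per j)) (x+x≈0 (u j)))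

  polynomial-• : ∀ {k} (t : Vector Parity k) (f u : ℕ → Carrier) → (∀ i → ⟦ t i ⟧ ≈ f (toℕ i)) →
    ∀ j → (polynomial t • u) j ≈ sumTo k (λ i → f i * u (i ℕ.+ j))
  polynomial-• {k} t f u t≈f j = go (λ i → constant (t i) *ₚ X ^ₚ toℕ i) (λ i → f i * u (i ℕ.+ j))
    (λ i → trans (*ₚ-• (constant (t i)) (X ^ₚ toℕ i) u j)
      (trans (+-identityʳ _) (*-cong (t≈f i) (X^-• (toℕ i) u j))))
    where
    -- The induction runs over arbitrary summands, because the tail of the sum carries the exponents
    -- from 1 on and is not itself a `polynomial`.
    go : ∀ {k} (p : Vector Poly k) (g : ℕ → Carrier) → (∀ i → (p i • u) j ≈ g (toℕ i)) →
      (Polyᵈ.sum p • u) j ≈ sumTo k g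
    go {zero}  p g p≈g = refl
    go {suc k} p g p≈g = trans (+ₚ-• (p Fin.zero) _ u j)
      (+-cong (p≈g Fin.zero) (go (λ i → p (Fin.suc i)) (λ i → g (suc i)) (λ i → p≈g (Fin.suc i))))

  -- The indicator of the index k. Acting on it and evaluating at 0 reads off the coefficient of xᵏ.
  unit-sequence : ℕ → ℕ → Carrier
  unit-sequence zero    zero    = 1#
  unit-sequence zero    (suc i) = 0#
  unit-sequence (suc k) zero    = 0#
  unit-sequence (suc k) (suc i) = unit-sequence k i

  coeff-• : ∀ p k → (p • unit-sequence k) 0 ≈ ⟦ coeff p k ⟧
  coeff-• []      k       = refl
  coeff-• (c ∷ p) zero    = trans
    (+-cong (*-identityʳ ⟦ c ⟧) (trans (sym (•-shift p (unit-sequence 0) 1 0)) (•-zero p 0)))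
    (+-identityʳ ⟦ c ⟧)
  coeff-• (c ∷ p) (suc k) = trans
    (+-cong (zeroʳ ⟦ c ⟧) (trans (sym (•-shift p (unit-sequence (suc k)) 1 0)) (coeff-• p k)))
    (+-identityˡ ⟦ coeff p k ⟧)

  -- Unit sequences detect every coefficient. Identities in 𝔽₂[x] can thus be proved as identities
  -- of actions.
  •-faithful : ∀ p q → (∀ u → (p • u) 0 ≈ (q • u) 0) → p ≈ₚ q
  •-faithful p q p≈q k = ι-injective (trans (sym (coeff-• p k)) (trans (p≈q (unit-sequence k)) (coeff-• q k)))

  -- The recursion v (k + j) = v j + u j is solved with v zero below k: `partial q r` adds up u at
  -- r, r + k, ..., r + (q - 1) k.
  X^-1-•-surjective : ∀ k .{{_ : NonZero k}} u →
    ∃[ v ] ∀ j → ((X ^ₚ k -ₚ 1ₚ) • v) j ≈ u j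
  X^-1-•-surjective k u = (λ j → partial (j / k) (j % k)) , λ j →
    trans (X^-1-• k _ j) (step j)
    where
    partial : ℕ → ℕ → Carrier
    partial zero    r = 0#
    partial (suc q) r = partial q r + u (r ℕ.+ q ℕ.* k)
    step : ∀ j → partial ((k ℕ.+ j) / k) ((k ℕ.+ j) % k) + partial (j / k) (j % k) ≈ u j
    step j = begin
      partial ((k ℕ.+ j) / k) ((k ℕ.+ j) % k) + partial (j / k) (j % k)
        ≈⟨ +-congʳ (reflexive (≡.cong₂ partial [k+j]/k [k+j]%k)) ⟩
      (partial (j / k) (j % k) + u (j % k ℕ.+ j / k ℕ.* k)) + partial (j / k) (j % k)
        ≈⟨ +-comm _ _ ⟩
      partial (j / k) (j % k) + (partial (j / k) (j % k) + u (j % k ℕ.+ j / k ℕ.* k))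
        ≈⟨ x+[x+y]≈y _ _ ⟩
      u (j % k ℕ.+ j / k ℕ.* k)
        ≈⟨ reflexive (cong u (m≡m%n+[m/n]*n j k)) ⟨
      u j ∎
      where
      [k+j]%k : (k ℕ.+ j) % k ≡ j % k
      [k+j]%k = ≡.trans (cong (_% k) (ℕ.+-comm k j)) ([m+n]%n≡m%n j k)
      [k+j]/k : (k ℕ.+ j) / k ≡ suc (j / k)
      [k+j]/k = ≡.trans (+-distrib-/-∣ˡ j ∣-refl) (cong (ℕ._+ j / k) (n/n≡1 k))

  -- Long division by xᵏ⁺¹ - 1

  module LongDivision (k : ℕ) where

    -- x (t (xᵏ⁺¹ − 1) + r) = (x t + b) (xᵏ⁺¹ − 1) + (b + x (r − b xᵏ)) for the
    -- coefficient b of xᵏ in r; values of the remainder beyond k are junk.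
    quotient : Poly → Poly
    remainder : Poly → ℕ → Parity
    quotient []      = []
    quotient (c ∷ p) = remainder p k ∷ quotient p
    remainder []      i       = 0ℙ
    remainder (c ∷ p) zero    = c ℙ.+ remainder p k
    remainder (c ∷ p) (suc i) = remainder p i

    division : ∀ p u j → (p • u) j ≈ (quotient p • (X ^ₚ suc k -ₚ 1ₚ) • u) j
      + sumTo (suc k) (λ i → ⟦ remainder p i ⟧ * u (i ℕ.+ j))
    division []      u j = sym (trans (+-identityˡ _) (sumTo-zero (suc k) (λ i → zeroˡ (u (i ℕ.+ j)))))
    division (c ∷ p) u j = begin
      ⟦ c ⟧ * u j + (p • u) (suc j)
        ≈⟨ +-congˡ (division p u (suc j)) ⟩
      ⟦ c ⟧ * u j + (T + sumTo (suc k) (λ i → r i * u (i ℕ.+ suc j)))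
        ≈⟨ +-congˡ (+-congˡ (trans (sumTo-last k _) (+-cong (sumTo-cong k (λ i → shift i)) (shift k)))) ⟩
      ⟦ c ⟧ * u j + (T + (S + r k * u (suc k ℕ.+ j)))
        -- The term `r k * u j` is inserted twice: one copy completes `r k` times the action of xᵏ⁺¹
        -- - 1, the other corrects the constant coefficient of the remainder.
        ≈⟨ +-congˡ (+-congˡ (+-congˡ (x+[x+y]≈y (r k * u j) _))) ⟨
      ⟦ c ⟧ * u j + (T + (S + (r k * u j + (r k * u j + r k * u (suc k ℕ.+ j)))))
        ≈⟨ rearrange _ _ _ _ _ ⟩
      ((r k * u (suc k ℕ.+ j) + r k * u j) + T) + ((⟦ c ⟧ * u j + r k * u j) + S)
        ≈⟨ +-cong (+-congʳ (trans (*-congˡ (X^-1-• (suc k) u j)) (distribˡ (r k) _ _)))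
                  (+-congʳ (trans (*-congʳ (ι-+ c (remainder p k))) (distribʳ (u j) ⟦ c ⟧ (r k)))) ⟨
      (quotient (c ∷ p) • (X ^ₚ suc k -ₚ 1ₚ) • u) j
        + sumTo (suc k) (λ i → ⟦ remainder (c ∷ p) i ⟧ * u (i ℕ.+ j)) ∎
      where
      r : ℕ → Carrier
      r i = ⟦ remainder p i ⟧
      T = (quotient p • (X ^ₚ suc k -ₚ 1ₚ) • u) (suc j)
      S = sumTo k (λ i → r i * u (suc i ℕ.+ j))
      shift : ∀ i → r i * u (i ℕ.+ suc j) ≈ r i * u (suc i ℕ.+ j)
      shift i = *-congˡ (reflexive (cong u (ℕ.+-suc i j)))
      rearrange : ∀ a b c d e → a + (b + (c + (d + (d + e)))) ≈ ((e + d) + b) + ((a + d) + c)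
      rearrange = solve 5 (λ a b c d e → a ⊕ (b ⊕ (c ⊕ (d ⊕ (d ⊕ e)))) ⊜ ((e ⊕ d) ⊕ b) ⊕ ((a ⊕ d) ⊕ c)) refl
        where open CommutativeMonoidSolver +-commutativeMonoid using (solve; _⊕_; _⊜_)

  -- The hypothesis on remainders gives h = t (xᵏ − 1), so (t e − 1) (xᵏ − 1) = 0;
  -- since xᵏ − 1 acts surjectively, t e = 1.
  divides-1 : ∀ k .{{_ : NonZero k}} h e → h *ₚ e ≈ₚ X ^ₚ k -ₚ 1ₚ →
    (∀ (r : ℕ → Parity) → (∀ {u} → Periodic k u → ∀ j →
       (h • u) j ≈ sumTo k (λ i → ⟦ r i ⟧ * u (i ℕ.+ j))) → ∀ i → i ℕ.< k → r i ≡ 0ℙ) →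
    e ∣ₚ 1ₚ
  divides-1 (suc k) h e he≈X^k-1 r≡0 = t , •-faithful (t *ₚ e) 1ₚ λ u →
    let (v , [X^k-1]v≈u) = X^-1-•-surjective (suc k) u in begin
      ((t *ₚ e) • u) 0                       ≈⟨ *ₚ-• t e u 0 ⟩
      (t • (e • u)) 0                        ≈⟨ •-comm t e u 0 ⟩
      (e • (t • u)) 0                        ≈⟨ •-cong e (•-cong t [X^k-1]v≈u) 0 ⟨
      (e • (t • (X ^ₚ suc k -ₚ 1ₚ) • v)) 0   ≈⟨ •-cong e (h≈t[X^k-1] v) 0 ⟨
      (e • (h • v)) 0                        ≈⟨ •-comm e h v 0 ⟩
      (h • (e • v)) 0                        ≈⟨ *ₚ-• h e v 0 ⟨
      ((h *ₚ e) • v) 0                       ≈⟨ •-congʳ (h *ₚ e) (X ^ₚ suc k -ₚ 1ₚ) v he≈X^k-1 0 ⟩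
      ((X ^ₚ suc k -ₚ 1ₚ) • v) 0             ≈⟨ [X^k-1]v≈u 0 ⟩
      u 0                                    ≈⟨ 1ₚ-• u 0 ⟨
      (1ₚ • u) 0                             ∎
    where
    open LongDivision k
    t = quotient h
    vanishing : ∀ i → i ℕ.< suc k → remainder h i ≡ 0ℙ
    -- On a sequence of period `suc k` the multiple of xᵏ⁺¹ - 1 acts as zero, so h acts there as its
    -- remainder.
    vanishing = r≡0 (remainder h) λ {u} per j → trans (division h u j)
      (trans (+-congʳ (trans (•-cong t (X^-1-•-periodic (suc k) per) j) (•-zero t j))) (+-identityˡ _))
    h≈t[X^k-1] : ∀ u j → (h • u) j ≈ (t • (X ^ₚ suc k -ₚ 1ₚ) • u) j
    h≈t[X^k-1] u j = trans (division h u j) (trans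
      (+-congˡ (trans (sumTo-cong-< (suc k) (λ i i<k →
          trans (*-congʳ (reflexive (cong ⟦_⟧ (vanishing i i<k)))) (zeroˡ (u (i ℕ.+ j)))))
        (sumTo-zero (suc k) (λ _ → refl))))
      (+-identityʳ _))

-- Parities of indices, and entries at reduced indices

open import Data.Nat.Base using (_+_; _*_; _^_)

parity-k*2 : ∀ k → parity (k * 2) ≡ 0ℙ
parity-k*2 zero    = ≡.refl
parity-k*2 (suc k) = parity-k*2 k

parity-1+k*2 : ∀ k → parity (suc (k * 2)) ≡ 1ℙ
parity-1+k*2 zero    = ≡.refl
parity-1+k*2 (suc k) = parity-1+k*2 k

-- `_‼_` computes only at a length of the form `suc n`; this version serves a nonzero length that is
-- a variable.
‼-mod : ∀ {n} .{{_ : NonZero n}} (a : Vector Parity n) j → ∃[ i ] a ‼ j ≡ a i × toℕ i ≡ j % n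
‼-mod {suc n} a j = j mod suc n , ≡.refl , toℕ-fromℕ< (m%n<n j (suc n))

-- Conjugates of a normal element and the trace form

module NormalElement {c ℓ₁ ℓ₂} (F : HeytingField c ℓ₁ ℓ₂) (n : ℕ) .{{n≢0 : NonZero n}}
  (fin : HasOrder F (2 ^ n)) (α : HeytingField.Carrier F) (normal : IsNormal F n α) where

  open CommutativeRing (fieldRing F) hiding (zero) renaming (_+_ to _⊕_; _*_ to _⊛_)
  open CommutativeSemiringExp commutativeSemiring
    using (^-assocʳ; ^-distrib-*; ^-congˡ; ^-congʳ; ^-homo-*) renaming (_^_ to _^ᶠ_)
  open HeytingFacts F
  open FiniteField F
  open RangeSums +-commutativeMonoid
  open Correlations (fieldRing F)
  open Characteristic2 (fieldRing F) (characteristic2 {n} fin)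
  open PolynomialAction F (characteristic2 {n} fin)
  open IsBasis normal
  open ≈-Reasoning setoid

  conjugates : ℕ → Carrier
  conjugates j = α ^ᶠ (2 ^ j)

  conjugates-orbit : FrobeniusOrbit conjugates
  conjugates-orbit j = trans (^-congʳ α (cong (2 ^ j +_) (ℕ.+-identityʳ (2 ^ j)))) (^-homo-* α (2 ^ j) (2 ^ j))

  conjugates-periodic : Periodic n conjugates
  conjugates-periodic i = begin
    α ^ᶠ (2 ^ (n + i))        ≈⟨ ^-congʳ α (ℕ.^-distribˡ-+-* 2 n i) ⟩
    α ^ᶠ (2 ^ n * 2 ^ i)      ≈⟨ ^-assocʳ α (2 ^ n) (2 ^ i) ⟨
    (α ^ᶠ (2 ^ n)) ^ᶠ (2 ^ i) ≈⟨ ^-congˡ (2 ^ i) (fermat fin α) ⟩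
    conjugates i              ∎

  autocorrelation : ℕ → Carrier
  autocorrelation = correlation n conjugates conjugates

  autocorrelation-periodic : Periodic n autocorrelation
  autocorrelation-periodic = correlation-periodic n n conjugates conjugates-periodic

  -- The 2ⁱ-th power of α α^(2ᵏ) is the product of the conjugates with indices i and k + i.
  Tr≈autocorrelation : ∀ k → Tr F n (α ⊛ conjugates k) ≈ autocorrelation k
  Tr≈autocorrelation k = trans
    (sumFin≈sumTo n (λ i → (α ⊛ conjugates k) ^ᶠ (2 ^ i)))
    (sumTo-cong n λ i → trans (^-distrib-* α (conjugates k) (2 ^ i)) (*-congˡ (trans
      (^-assocʳ α (2 ^ k) (2 ^ i)) (^-congʳ α (≡.sym (ℕ.^-distribˡ-+-* 2 k i))))))

  sequence-independent : ∀ (r : ℕ → Parity) → sumTo n (λ i → ⟦ r i ⟧ ⊛ conjugates i) ≈ 0# →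
    ∀ i → i ℕ.< n → r i ≡ 0ℙ
  sequence-independent r Σ≈0 i i<n = ≡.trans (cong r (≡.sym (toℕ-fromℕ< i<n)))
    (independent (λ j → r (toℕ j)) (trans (sumFin≈sumTo n (λ j → ⟦ r j ⟧ ⊛ conjugates j)) Σ≈0) (fromℕ< i<n))

  -- Turns a combination of basis elements into a polynomial acting on their sequence, so that the
  -- results on orbits apply to it.
  tabulate-• : ∀ {k} (γ : Vector Parity k) u →
    (List.tabulate γ • u) 0 ≈ linearCombination F γ (λ i → u (toℕ i))
  tabulate-• {zero}  γ u = refl
  tabulate-• {suc k} γ u = +-congˡ
    (trans (sym (•-shift (List.tabulate (λ i → γ (Fin.suc i))) u 1 0)) (tabulate-• (λ i → γ (Fin.suc i)) (λ i → u (suc i))))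

  -- The trace equals its own square, so it is 0 or 1; the value 0 would be a linear dependence with
  -- all coefficients 1.
  trace≈1 : sumTo n conjugates ≈ 1#
  trace≈1 with zero⊎unit fin (sumTo n conjugates)
  ... | inj₁ t≈0 = contradiction
          (sequence-independent (λ _ → 1ℙ) (trans (sumTo-cong n (λ i → *-identityˡ (conjugates i))) t≈0)
            0 (ℕ.>-nonZero⁻¹ n)) λ ()
  ... | inj₂ t-unit = cancelˡ-unit t-unit (begin
    t ⊛ t                                          ≈⟨ square-sumTo n conjugates ⟩
    sumTo n (λ i → conjugates i ⊛ conjugates i)    ≈⟨ correlation-0 n conjugates-orbit conjugates-periodic ⟩
    t                                              ≈⟨ *-identityʳ t ⟨
    t ⊛ 1#                                         ∎)
    where t = sumTo n conjugates

  -- A correlation is linear in its second sequence, and shifting k shifts that sequence.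
  •-correlation : ∀ p d u v k → (p • correlation d u v) k ≈ correlation d u (p • v) k
  •-correlation p d u v k = trans (•-sumTo p d (λ r i → u r ⊛ v (i + r)) k)
    (sumTo-cong d λ r → trans (•-* p (u r) (λ i → v (i + r)) k) (*-congˡ (begin
      (p • (λ i → v (i + r))) k  ≈⟨ •-cong p (λ i → reflexive (cong v (ℕ.+-comm i r))) k ⟩
      (p • (λ i → v (r + i))) k  ≈⟨ •-shift p v r k ⟩
      (p • v) (r + k)            ≈⟨ reflexive (cong (p • v) (ℕ.+-comm r k)) ⟩
      (p • v) (k + r)            ∎)))

  -- If y₀ ≠ 0, write α / y₀ as a combination of conjugates; then Tr α = 1 is the
  -- same combination of the vanishing Tr (y₀ α^(2ˡ)).
  correlation-nondegenerate : ∀ {y} → FrobeniusOrbit y → Periodic n y →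
    (∀ k → correlation n conjugates y k ≈ 0#) → y 0 ≈ 0#
  correlation-nondegenerate {y} orb per vanishing with zero⊎unit fin (y 0)
  ... | inj₁ y₀≈0 = y₀≈0
  ... | inj₂ (z , y₀z≈1) with spanning (α ⊛ z)
  ...   | γ , γ≈αz = contradiction (begin
    1#                                         ≈⟨ trace≈1 ⟨
    -- The equation `α≈y₀[pα]` at index 0 extends to all indices, since both sides are Frobenius
    -- orbits.
    sumTo n conjugates                         ≈⟨ sumTo-cong n (orbit-unique conjugates-orbit (*-orbit orb (•-orbit p conjugates-orbit)) α≈y₀[pα]) ⟩
    correlation n y (p • conjugates) 0         ≈⟨ •-correlation p n y conjugates 0 ⟨
    (p • correlation n y conjugates) 0         ≈⟨ •-cong p vanishing′ 0 ⟩
    (p • (λ _ → 0#)) 0                         ≈⟨ •-zero p 0 ⟩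
    0#                                         ∎) 1≉0
    where
    p = List.tabulate γ
    α≈y₀[pα] : conjugates 0 ≈ y 0 ⊛ (p • conjugates) 0
    α≈y₀[pα] = begin
      conjugates 0                  ≈⟨ *-identityʳ α ⟩
      α                             ≈⟨ *-identityʳ α ⟨
      α ⊛ 1#                        ≈⟨ *-congˡ y₀z≈1 ⟨
      α ⊛ (y 0 ⊛ z)                 ≈⟨ x∙yz≈y∙xz α (y 0) z ⟩
      y 0 ⊛ (α ⊛ z)                 ≈⟨ *-congˡ (trans (tabulate-• γ conjugates) γ≈αz) ⟨
      y 0 ⊛ (p • conjugates) 0      ∎
      where open CommutativeSemigroupProperties *-commutativeSemigroup using (x∙yz≈y∙xz)
    vanishing′ : ∀ k → correlation n y conjugates k ≈ 0#
    vanishing′ k = trans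
      -- The shift `pred n * k` represents -k modulo n, as the two shifts add up to k n.
      (correlation-reflect n per conjugates-periodic k (ℕ.pred n * k) k
        (≡.trans (ℕ.*-comm (suc (ℕ.pred n)) k) (cong (k *_) (ℕ.suc-pred n))))
      (vanishing (ℕ.pred n * k))

  -- Both sides depend on j only modulo n, so the defining relation for j < n extends to every j.
  entry : ∀ (a : Vector Parity n) → IsCorrespondingVector F α a → ∀ j → ⟦ a ‼ j ⟧ ≈ autocorrelation j
  entry a a-corr j with ‼-mod a j
  ... | i , aⱼ≡aᵢ , i≡j%n = begin
    ⟦ a ‼ j ⟧                       ≈⟨ reflexive (cong ⟦_⟧ aⱼ≡aᵢ) ⟩
    ⟦ a i ⟧                         ≈⟨ a-corr i ⟩
    Tr F n (α ⊛ conjugates (toℕ i)) ≈⟨ Tr≈autocorrelation (toℕ i) ⟩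
    autocorrelation (toℕ i)         ≈⟨ reflexive (cong autocorrelation i≡j%n) ⟩
    autocorrelation (j % n)         ≈⟨ periodic-multiple autocorrelation-periodic (j / n) (j % n) ⟨
    autocorrelation (j / n * n + j % n)
      ≈⟨ reflexive (cong autocorrelation (≡.trans (m≡m%n+[m/n]*n j n) (ℕ.+-comm (j % n) _))) ⟨
    autocorrelation j               ∎

  -- Folding modulo a divisor d of n

  module Folding (q d : ℕ) .{{d≢0 : NonZero d}} (n≡qd : n ≡ q * d) where

    traces : ℕ → Carrier
    traces = class-sum q d conjugates

    traces-orbit : FrobeniusOrbit traces
    traces-orbit = class-sum-orbit q d conjugates-orbit

    traces-periodic : Periodic d traces
    traces-periodic = class-sum-periodic q d n≡qd conjugates-periodic

    traces-total : sumTo d traces ≈ 1#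
    traces-total = trans (sumTo-class-sum q d conjugates n≡qd) trace≈1

    folded : ∀ k → class-sum q d autocorrelation k ≈ correlation d traces traces k
    folded = class-sum-correlation q d n≡qd conjugates-periodic

    -- The d-periodic extension of (1, 0, ..., 0). A polynomial acting on it displays its
    -- coefficients modulo xᵈ - 1 in reversed cyclic order.
    comb : ℕ → Carrier
    comb j = unit-sequence 0 (j % d)

    comb-periodic : Periodic d comb
    comb-periodic = %-periodic d (unit-sequence 0)

    correlation-comb : ∀ v k → correlation d comb v k ≈ v k
    correlation-comb v k = begin
      sumTo d (λ r → comb r ⊛ v (k + r))
        ≈⟨ sumTo-cong-< d (λ r r<d → *-congʳ (reflexive (cong (unit-sequence 0) (m<n⇒m%n≡m r<d)))) ⟩
      sumTo d (λ r → unit-sequence 0 r ⊛ v (k + r))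
        ≈⟨ reflexive (cong (λ d → sumTo d (λ r → unit-sequence 0 r ⊛ v (k + r))) (ℕ.suc-pred d)) ⟨
      1# ⊛ v (k + 0) ⊕ sumTo (ℕ.pred d) (λ r → 0# ⊛ v (k + suc r))
        ≈⟨ +-cong (*-identityˡ _) (sumTo-zero (ℕ.pred d) (λ r → zeroˡ _)) ⟩
      v (k + 0) ⊕ 0#
        ≈⟨ trans (+-identityʳ _) (reflexive (cong v (ℕ.+-identityʳ k))) ⟩
      v k ∎

    -- Acting on `comb` reverses the coefficient sequence κ, but κ is an autocorrelation and so is
    -- unchanged by reversal. Unfolding one factor of κ j then gives the trace of α times
    -- `traces j`.
    folded-polynomial : ∀ (t : Vector Parity d) → (∀ i → ⟦ t i ⟧ ≈ class-sum q d autocorrelation (toℕ i)) →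
      ∀ j → (polynomial t • comb) j ≈ correlation n conjugates traces j
    folded-polynomial t t≈folded j = begin
      (polynomial t • comb) j
        ≈⟨ polynomial-• t κ comb (λ i → trans (t≈folded i) (folded (toℕ i))) j ⟩
      sumTo d (λ i → κ i ⊛ comb (i + j))
        ≈⟨ sumTo-cong d (λ i → *-congˡ (reflexive (cong comb (ℕ.+-comm i j)))) ⟩
      correlation d κ comb j
        ≈⟨ correlation-reflect d (correlation-periodic d d traces traces-periodic) comb-periodic j j′ j j+j′ ⟩
      correlation d comb κ j′
        ≈⟨ correlation-comb κ j′ ⟩
      κ j′
        ≈⟨ correlation-reflect d traces-periodic traces-periodic j j′ j j+j′ ⟨
      κ j
        ≈⟨ correlation-class-sumˡ q d conjugates n≡qd traces-periodic j ⟨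
      correlation n conjugates traces j ∎
      where
      κ = correlation d traces traces
      j′ = ℕ.pred d * j
      j+j′ : j + j′ ≡ j * d
      j+j′ = ≡.trans (ℕ.*-comm (suc (ℕ.pred d)) j) (cong (j *_) (ℕ.suc-pred d))

    -- A combination of the first d relative traces is the combination of all n conjugates whose
    -- coefficients repeat with period d.
    traces-independent : ∀ (r : ℕ → Parity) → sumTo d (λ i → ⟦ r i ⟧ ⊛ traces (i + 0)) ≈ 0# →
      ∀ i → i ℕ.< d → r i ≡ 0ℙ
    traces-independent r Σ≈0 i i<d = ≡.trans (cong r (≡.sym (m<n⇒m%n≡m i<d)))
      (sequence-independent (λ j → r (j % d)) Σ′≈0 i (ℕ.<-≤-trans i<d d≤n))
      where
      instance
        q≢0 : NonZero q
        q≢0 = ℕ.m*n≢0⇒m≢0 q {{≡.subst NonZero n≡qd n≢0}}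
      d≤n : d ≤ n
      d≤n = ≡.subst (d ≤_) (≡.sym n≡qd) (ℕ.m≤n*m d q)
      Σ′≈0 : sumTo n (λ j → ⟦ r (j % d) ⟧ ⊛ conjugates j) ≈ 0#
      Σ′≈0 = begin
        sumTo n (λ j → ⟦ r (j % d) ⟧ ⊛ conjugates j)
          ≈⟨ sumTo-cong n (λ j → *-comm _ _) ⟩
        correlation n conjugates (λ j → ⟦ r (j % d) ⟧) 0
          ≈⟨ correlation-class-sumˡ q d conjugates n≡qd (%-periodic d (λ k → ⟦ r k ⟧)) 0 ⟩
        correlation d traces (λ j → ⟦ r (j % d) ⟧) 0
          ≈⟨ sumTo-cong-< d (λ j j<d → trans (*-comm _ _)
               (*-cong (reflexive (cong (λ k → ⟦ r k ⟧) (m<n⇒m%n≡m j<d)))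
                       (reflexive (cong traces (≡.sym (ℕ.+-identityʳ j)))))) ⟩
        sumTo d (λ j → ⟦ r j ⟧ ⊛ traces (j + 0))
          ≈⟨ Σ≈0 ⟩
        0# ∎

    -- If e h = xᵈ − 1 and e divides the polynomial, then h kills its action on
    -- comb, i.e. every Tr (α^(2ᵏ) y) vanishes for y = h • traces.
    folded-gcd : ∀ (t : Vector Parity d) → (∀ i → ⟦ t i ⟧ ≈ class-sum q d autocorrelation (toℕ i)) →
      IsGCD (polynomial t) (X ^ₚ d -ₚ 1ₚ) 1ₚ
    folded-gcd t t≈folded = record
      { divides₁ = 1ₚ∣ (polynomial t)
      ; divides₂ = 1ₚ∣ (X ^ₚ d -ₚ 1ₚ)
      ; greatest = coprime
      }
      where
      1ₚ∣ : ∀ p → 1ₚ ∣ₚ p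
      1ₚ∣ p = p , •-faithful (p *ₚ 1ₚ) p (λ u → trans (*ₚ-• p 1ₚ u 0) (•-cong p (1ₚ-• u) 0))
      coprime : ∀ {e} → e ∣ₚ polynomial t → e ∣ₚ X ^ₚ d -ₚ 1ₚ → e ∣ₚ 1ₚ
      coprime {e} (g , ge≈t) (h , he≈X^d-1) = divides-1 d h e he≈X^d-1 λ r h≈r →
        -- At index 0, h acting on `traces` is on one side the combination of traces with
        -- coefficients r, on the other side 0 by nondegeneracy.
        traces-independent r (trans (sym (h≈r traces-periodic 0))
          (correlation-nondegenerate (•-orbit h traces-orbit)
            (•-periodic h (λ i → trans (reflexive (cong (λ n → traces (n + i)) n≡qd)) (periodic-multiple traces-periodic q i)))
            vanishing))
        where
        vanishing : ∀ k → correlation n conjugates (h • traces) k ≈ 0#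
        vanishing k = begin
          correlation n conjugates (h • traces) k   ≈⟨ •-correlation h n conjugates traces k ⟨
          (h • correlation n conjugates traces) k   ≈⟨ •-cong h (folded-polynomial t t≈folded) k ⟨
          (h • (polynomial t • comb)) k             ≈⟨ •-cong h (•-congʳ (g *ₚ e) (polynomial t) comb ge≈t) k ⟨
          (h • ((g *ₚ e) • comb)) k                 ≈⟨ •-cong h (*ₚ-• g e comb) k ⟩
          (h • (g • (e • comb))) k                  ≈⟨ •-comm h g (e • comb) k ⟩
          (g • (h • (e • comb))) k                  ≈⟨ •-cong g (*ₚ-• h e comb) k ⟨
          (g • ((h *ₚ e) • comb)) k                 ≈⟨ •-cong g (•-congʳ (h *ₚ e) (X ^ₚ d -ₚ 1ₚ) comb he≈X^d-1) k ⟩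
          (g • ((X ^ₚ d -ₚ 1ₚ) • comb)) k           ≈⟨ •-cong g (X^-1-•-periodic d comb-periodic) k ⟩
          (g • (λ _ → 0#)) k                        ≈⟨ •-zero g k ⟩
          0#                                        ∎

    -- The three assertions in terms of the entries of the corresponding vector

    module _ (a : Vector Parity n) (a-corr : IsCorrespondingVector F α a) where

      folded-entries : ∀ k → ⟦ ∑[ i < q ] (a ‼ (toℕ i * d + k)) ⟧ ≈ class-sum q d autocorrelation k
      folded-entries k = ι-sum {q} _ (λ i → autocorrelation (i * d + k)) (λ i → entry a a-corr (toℕ i * d + k))

      multiples-sum : ∑[ i < q ] (a ‼ (toℕ i * d)) ≡ 1ℙ
      multiples-sum = ι-injective (begin
        ⟦ ∑[ i < q ] (a ‼ (toℕ i * d)) ⟧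
          ≈⟨ ι-sum {q} _ (λ i → autocorrelation (i * d + 0)) (λ i → trans
               (reflexive (cong (λ j → ⟦ a ‼ j ⟧) (≡.sym (ℕ.+-identityʳ (toℕ i * d))))) (entry a a-corr (toℕ i * d + 0))) ⟩
        class-sum q d autocorrelation 0  ≈⟨ folded 0 ⟩
        correlation d traces traces 0    ≈⟨ correlation-0 d traces-orbit traces-periodic ⟩
        sumTo d traces                   ≈⟨ traces-total ⟩
        1#                               ∎)

      half-sum : ∀ h → d ≡ h + h → ∑[ i < q ] (a ‼ (toℕ i * d + h)) ≡ 0ℙ
      half-sum h d≡h+h = ι-injective
        (trans (folded-entries h) (trans (folded h) (correlation-half h d≡h+h traces-periodic)))

      -- As h = 2M, the range splits into M even k, which contribute 0, and M odd k, which give the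
      -- correlations at the odd shifts below d / 2.
      odd-sum : ∀ h M → h ≡ M * 2 → d ≡ (M + M) * 2 →
        ∑[ k < h ] (if does (parity (toℕ k) ≟ 1ℙ) then ∑[ i < q ] (a ‼ (toℕ i * d + toℕ k)) else 0ℙ) ≡ 1ℙ
      odd-sum h M ≡.refl d≡2M*2 = ι-injective (begin
        ⟦ ∑[ k < h ] restrict (toℕ k) ⟧
          ≈⟨ ι-sum {h} _ (λ k → ⟦ restrict k ⟧) (λ k → refl) ⟩
        sumTo (M * 2) (λ k → ⟦ restrict k ⟧)
          ≈⟨ sumTo-even-odd M (λ k → ⟦ restrict k ⟧) ⟩
        sumTo M (λ k → ⟦ restrict (k * 2) ⟧) ⊕ sumTo M (λ k → ⟦ restrict (suc (k * 2)) ⟧)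
          ≈⟨ +-cong (sumTo-zero M (λ k → reflexive (cong ⟦_⟧ (restrict-even k)))) (sumTo-cong M (λ k → trans
               (reflexive (cong ⟦_⟧ (restrict-odd k)))
               (trans (folded-entries (suc (k * 2))) (folded (suc (k * 2)))))) ⟩
        0# ⊕ sumTo M (λ k → correlation d traces traces (suc (k * 2)))
          ≈⟨ trans (+-identityˡ _)
               (sumTo-odd-correlations M d≡2M*2 traces-orbit traces-periodic traces-total) ⟩
        1# ∎)
        where
        restrict : ℕ → Parity
        restrict k = if does (parity k ≟ 1ℙ) then ∑[ i < q ] (a ‼ (toℕ i * d + k)) else 0ℙ
        restrict-even : ∀ k → restrict (k * 2) ≡ 0ℙ
        restrict-even k rewrite parity-k*2 k = ≡.refl
        restrict-odd : ∀ k → restrict (suc (k * 2)) ≡ ∑[ i < q ] (a ‼ (toℕ i * d + suc (k * 2)))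
        restrict-odd k rewrite parity-1+k*2 k = ≡.refl

      coprime-fold : IsGCD (polynomial (λ (k : Fin d) → ∑[ i < q ] (a ‼ (toℕ i * d + toℕ k)))) (X ^ₚ d -ₚ 1ₚ) 1ₚ
      coprime-fold = folded-gcd _ (λ k → folded-entries (toℕ k))

proposition5p2 : ∀ {c ℓ₁ ℓ₂} (n s m : ℕ) → n ≡ 2 ^ s * m → 4 ≤ 2 ^ s → parity m ≡ 1ℙ →
    (F : HeytingField c ℓ₁ ℓ₂) → HasOrder F (2 ^ n) →
    (a : Vector Parity n) → IsSymmetric a →
    (α : HeytingField.Carrier F) → IsNormal F n α → IsCorrespondingVector F α a →
    ( ∑[ i < m ] (a ‼ (toℕ i * 2 ^ s)) ≡ 1ℙ
    × ∑[ i < m ] (a ‼ (toℕ i * 2 ^ s + 2 ^ (s ∸ 1))) ≡ 0ℙ )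
    × ∑[ k < 2 ^ (s ∸ 1) ] (if does (parity (toℕ k) ≟ 1ℙ) then ∑[ i < m ] (a ‼ (toℕ i * 2 ^ s + toℕ k)) else 0ℙ) ≡ 1ℙ
    × IsGCD (polynomial (λ (k : Fin m) → ∑[ i < 2 ^ s ] (a ‼ (toℕ i * m + toℕ k)))) (X ^ₚ m -ₚ 1ₚ) 1ₚ
proposition5p2 n 0 m n≡ (s≤s ()) _ _ _ _ _ _ _ _
proposition5p2 n 1 m n≡ (s≤s (s≤s ())) _ _ _ _ _ _ _ _
-- The case m = 0 is void, since `parity 0` is `0ℙ`.
proposition5p2 n s@(suc (suc r)) m@(suc _) n≡Nm _ _ F fin a _ α normal a-corr =
  ( ByTwoPower.multiples-sum a a-corr
  , ByTwoPower.half-sum a a-corr (2 ^ suc r) (cong (2 ^ suc r +_) (ℕ.+-identityʳ (2 ^ suc r))) )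
  , ByTwoPower.odd-sum a a-corr (2 ^ suc r) M (ℕ.*-comm 2 M) N≡2M*2
  , ByOddPart.coprime-fold a a-corr
  where
  -- With s = r + 2, this is the number of odd k below 2^(s - 1).
  M = 2 ^ r
  N = 2 ^ s
  instance
    N≢0 : NonZero N
    N≢0 = ℕ.m^n≢0 2 s
    n≢0 : NonZero n
    n≢0 = ≡.subst NonZero (≡.sym n≡Nm) (ℕ.m*n≢0 N m)
  n≡mN : n ≡ m * N
  n≡mN = ≡.trans n≡Nm (ℕ.*-comm N m)
  N≡2M*2 : N ≡ (M + M) * 2
  N≡2M*2 = solve 1 (λ M → con 2 :* (con 2 :* M) := (M :+ M) :* con 2) ≡.refl M
    where open +-*-Solver
  open NormalElement F n fin α normal using (module Folding)
  -- Assertions 1 and 2 fold modulo d = 2^s with q = m; assertion 3 exchanges the two roles.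
  module ByTwoPower = Folding m N n≡mN
  module ByOddPart  = Folding N m n≡Nm
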